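{- For each positive integer $n$, let $c(n,5)$ be the maximum of $c(T,5)$ over all tournaments $T$ on $n$ vertices, where $c(T,5)$ is the number of directed 5-cycles in $T$. Then $c(n,5)$ is asymptotically equal to $\frac{3}{4}\binom{n}{5}$, that is, $$\lim_{n\to\infty} \frac{c(n,5)}{\frac{3}{4}\binom{n}{5}} = 1.$$
   Context: A tournament on $n$ vertices (an $n$-tournament) is a directed graph $T=(V,E)$ with $|V|=n$, without loops, such that for every pair of distinct vertices $u,v$ exactly one of $(u,v),(v,u)$ lies in $E$. The quantity $c(T,k)$ is the number of directed $k$-cycles of $T$, counted as subgraphs (i.e. cyclic rotations of the same vertex sequence give the same cycle). The number $\frac34\binom n5$ is the expected number of directed 5-cycles in a uniformly random tournament on $n$ labeled vertices (each edge oriented independently with probability $\frac12$ each way). -}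

module Defs where

open import Data.Bool using (Bool; true; false; not)
import Data.Bool.Properties as Bool
open import Data.Empty using (⊥)
open import Data.Fin using (Fin; _<_)
open import Data.Fin.Properties
  using (_≟_; _<?_; <-cmp; <-asym; <-trans)
import Data.Integer as ℤ
open import Data.List using (List; []; _∷_; [_]; _++_; _∷ʳ_; length; filter; map;
  cartesianProductWith; allFin)
open import Data.List.Properties using (filter-≐; ++-assoc; ++-identityʳ)
open import Data.List.Membership.Propositional using (_∈_)
open import Data.List.Membership.Propositional.Properties
  using (∈-cartesianProductWith⁺; ∈-map⁺)
open import Data.List.Relation.Unary.All as All using (All; []; _∷_)
import Data.List.Relation.Unary.All.Properties as All
open import Data.List.Relation.Unary.AllPairs as AllPairs using ([]; _∷_)
import Data.List.Relation.Unary.AllPairs.Properties as AllPairs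
open import Data.List.Relation.Unary.Any using (here; there)
open import Data.List.Relation.Unary.Linked as Linked using (Linked; []; [-]; _∷_; linked?)
open import Data.Nat as ℕ using (ℕ; zero; suc)
open import Data.Nat.Combinatorics using (_C_; nCk≡n!/k![n-k]!; k![n∸k]!∣n!)
open import Data.Nat.Divisibility using (∣⇒≤)
open import Data.Nat.DivMod using (m≥n⇒m/n>0)
import Data.Nat.Properties as ℕ
open import Data.Nat.Properties using (_!≢0; _!*_!≢0)
open import Data.Product using (∃₂; ∃-syntax; _×_; _,_)
open import Data.Rational as ℚ using (ℚ; 0ℚ; _÷_; _*_; _-_; ∣_∣; _/_)
import Data.Rational.Properties as ℚ
open import Data.Unit using (⊤; tt)
open import Data.Vec as Vec using (Vec; []; _∷_; toList; lookup; tabulate)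
open import Data.Vec.Properties using (lookup∘tabulate)
open import Function using (_∘_)
open import Relation.Binary using (tri<; tri≈; tri>)
open import Relation.Binary.PropositionalEquality
  using (_≡_; _≢_; refl; sym; trans; cong; subst)
open import Relation.Nullary using (Dec; yes; no; contradiction)
open import Relation.Nullary.Decidable using (_×-dec_)
open import Data.List.Extrema ℕ.≤-totalOrder using (argmax; f[xs]≤f[argmax])

record Tournament (n : ℕ) : Set where
  field
    edge       : Fin n → Fin n → Bool
    noLoop     : ∀ u → edge u u ≡ false
    exactlyOne : ∀ u v → u ≢ v → edge v u ≡ not (edge u v)

  infix 4 _⟶_
  _⟶_ : Fin n → Fin n → Set
  u ⟶ v = edge u v ≡ true

open Tournament using (edge)

module _ {n : ℕ} where

  open import Data.List.Relation.Unary.Unique.DecPropositional {A = Fin n} _≟_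
    using (Unique; unique?)

  IsCycle : Tournament n → List (Fin n) → Set
  IsCycle T []       = ⊥
  IsCycle T (v ∷ vs) = Unique (v ∷ vs) × Linked (Tournament._⟶_ T) (v ∷ vs ∷ʳ v)

  LeastFirst : List (Fin n) → Set
  LeastFirst []       = ⊤
  LeastFirst (v ∷ vs) = All (v <_) vs

  isCycle? : ∀ T vs → Dec (IsCycle T vs)
  isCycle? T []       = no λ ()
  isCycle? T (v ∷ vs) =
    unique? (v ∷ vs) ×-dec linked? (λ u w → edge T u w Bool.≟ true) (v ∷ vs ∷ʳ v)

  leastFirst? : ∀ vs → Dec (LeastFirst vs)
  leastFirst? []       = yes tt
  leastFirst? (v ∷ vs) = All.all? (v <?_) vs

  -- The vertex sequences of a cycle (as a subgraph) are the cyclic rotations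
  -- of any one of them.  The two lemmas below show that each such class has
  -- exactly one member starting at the least vertex, so cycles are counted by
  -- these representatives.

  infix 4 _≈ʳ_
  _≈ʳ_ : List (Fin n) → List (Fin n) → Set
  vs ≈ʳ ws = ∃₂ λ as bs → vs ≡ as ++ bs × ws ≡ bs ++ as

  private

    splitMin : ∀ v vs → Unique (v ∷ vs) →
               ∃₂ λ as bs → ∃[ m ] v ∷ vs ≡ as ++ m ∷ bs × All (m <_) as × All (m <_) bs
    splitMin v []       _        = [] , [] , v , refl , [] , []
    splitMin v (w ∷ ws) ((v≢w ∷ v≢) ∷ uq) with splitMin w ws uq
    ... | as , bs , m , eq , m<as , m<bs with <-cmp v m
    ...   | tri< v<m _ _ = [] , w ∷ ws , v , refl , [] ,
            subst (All (v <_)) (sym eq)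
              (All.++⁺ (All.map (<-trans v<m) m<as) (v<m ∷ All.map (<-trans v<m) m<bs))
    ...   | tri≈ _ refl _ = contradiction refl
            (All.head (All.++⁻ʳ as (subst (All (v ≢_)) eq (v≢w ∷ v≢))))
    ...   | tri> _ _ m<v = v ∷ as , bs , m , cong (v ∷_) eq , m<v ∷ m<as , m<bs

    Linked-++⁻ʳ : ∀ {R : Fin n → Fin n → Set} xs {ys} → Linked R (xs ++ ys) → Linked R ys
    Linked-++⁻ʳ []       l = l
    Linked-++⁻ʳ (x ∷ xs) l = Linked-++⁻ʳ xs (Linked.tail l)

    Linked-init : ∀ {R : Fin n → Fin n → Set} xs {x ys} →
                  Linked R (xs ++ x ∷ ys) → Linked R (xs ∷ʳ x)
    Linked-init []           _       = [-]
    Linked-init (x ∷ [])     (r ∷ _) = r ∷ [-]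
    Linked-init (x ∷ y ∷ xs) (r ∷ l) = r ∷ Linked-init (y ∷ xs) l

    Linked-join : ∀ {R : Fin n → Fin n → Set} xs {x ys} →
                  Linked R (xs ∷ʳ x) → Linked R (x ∷ ys) → Linked R (xs ++ x ∷ ys)
    Linked-join []           _       l = l
    Linked-join (x ∷ [])     (r ∷ _) l = r ∷ l
    Linked-join (x ∷ y ∷ xs) (r ∷ k) l = r ∷ Linked-join (y ∷ xs) k l

    Unique-swap : ∀ as {bs} → Unique (as ++ bs) → Unique (bs ++ as)
    Unique-swap []       {bs} uq        = subst Unique (sym (++-identityʳ bs)) uq
    Unique-swap (a ∷ as) {bs} (a≢ ∷ uq) = subst Unique (++-assoc bs [ a ] as)
      (Unique-swap as (subst Unique (++-assoc as bs [ a ])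
        (AllPairs.++⁺ uq ([] ∷ []) (All.map (λ a≢x → (a≢x ∘ sym) ∷ []) a≢))))

  leastFirst-exists : ∀ T vs → IsCycle T vs →
                      ∃[ ws ] vs ≈ʳ ws × IsCycle T ws × LeastFirst ws
  leastFirst-exists T (v ∷ vs) (uq , l) with splitMin v vs uq
  ... | [] , bs , m , refl , _ , m<bs =
    v ∷ vs , ([] , v ∷ vs , refl , sym (++-identityʳ _)) , (uq , l) , m<bs
  ... | a ∷ as , bs , m , refl , m<a ∷ m<as , m<bs =
    m ∷ bs ++ a ∷ as , (a ∷ as , m ∷ bs , refl , refl) ,
    (Unique-swap (a ∷ as) uq ,
     subst (Linked _) (cong (m ∷_) (sym (++-assoc bs (a ∷ as) [ m ])))
       (Linked-join (m ∷ bs) (Linked-++⁻ʳ (a ∷ as) l′) (Linked-init (a ∷ as) l′))) ,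
    All.++⁺ m<bs (m<a ∷ m<as)
    where
    l′ : Linked (Tournament._⟶_ T) ((a ∷ as) ++ (m ∷ bs) ∷ʳ a)
    l′ = subst (Linked _) (cong (a ∷_) (++-assoc as (m ∷ bs) [ a ])) l

  leastFirst-unique : ∀ {vs ws} → vs ≈ʳ ws → LeastFirst vs → LeastFirst ws → vs ≡ ws
  leastFirst-unique ([]     , bs     , refl , refl) _ _ = sym (++-identityʳ bs)
  leastFirst-unique (a ∷ as , []     , refl , refl) _ _ = ++-identityʳ (a ∷ as)
  leastFirst-unique (a ∷ as , b ∷ bs , refl , refl) p q =
    contradiction (All.head (All.++⁻ʳ bs q)) (<-asym (All.head (All.++⁻ʳ as p)))

  isRep? : ∀ T {k} (vs : Vec (Fin n) k) → Dec (IsCycle T (toList vs) × LeastFirst (toList vs))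
  isRep? T vs = isCycle? T (toList vs) ×-dec leastFirst? (toList vs)

vectors : ∀ {A : Set} → List A → ∀ k → List (Vec A k)
vectors xs zero    = [ [] ]
vectors xs (suc k) = cartesianProductWith _∷_ xs (vectors xs k)

numCycles : ∀ {n} → Tournament n → ℕ → ℕ
numCycles {n} T k = length (filter (isRep? T) (vectors (allFin n) k))

-- Every tournament is obtained (up to pointwise equality of `edge`) by
-- reading the entries above the diagonal of some Boolean matrix.
orient : ∀ {n} → Vec (Vec Bool n) n → Tournament n
orient {n} M = record { edge = e ; noLoop = loop ; exactlyOne = one }
  where
  e : Fin n → Fin n → Bool
  e u v with <-cmp u v
  ... | tri< _ _ _ = lookup (lookup M u) v
  ... | tri≈ _ _ _ = false
  ... | tri> _ _ _ = not (lookup (lookup M v) u)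

  loop : ∀ u → e u u ≡ false
  loop u with <-cmp u u
  ... | tri< _ u≢u _ = contradiction refl u≢u
  ... | tri≈ _ _ _   = refl
  ... | tri> _ u≢u _ = contradiction refl u≢u

  one : ∀ u v → u ≢ v → e v u ≡ not (e u v)
  one u v u≢v with <-cmp u v | <-cmp v u
  ... | tri≈ _ u≡v _ | _            = contradiction u≡v u≢v
  ... | _            | tri≈ _ v≡u _ = contradiction (sym v≡u) u≢v
  ... | tri< u<v _ _ | tri< v<u _ _ = contradiction v<u (<-asym u<v)
  ... | tri> _ _ v<u | tri> _ _ u<v = contradiction v<u (<-asym u<v)
  ... | tri< _ _ _   | tri> _ _ _   = refl
  ... | tri> _ _ _   | tri< _ _ _   = sym (Bool.not-involutive _)

tournaments : ∀ n → List (Tournament n)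
tournaments n = map orient (vectors (vectors (true ∷ false ∷ []) n) n)

transitive : ∀ n → Tournament n
transitive n = orient (Vec.replicate n (Vec.replicate n true))

maxCycles : ℕ → ℕ → ℕ
maxCycles n k = numCycles (argmax (λ T → numCycles T k) (transitive n) (tournaments n)) k

private

  vectors-complete : ∀ {A : Set} {xs : List A} → (∀ x → x ∈ xs) →
                     ∀ {k} (v : Vec A k) → v ∈ vectors xs k
  vectors-complete all []      = here refl
  vectors-complete all (x ∷ v) = ∈-cartesianProductWith⁺ _∷_ (all x) (vectors-complete all v)

  bools : ∀ b → b ∈ true ∷ false ∷ []
  bools true  = here refl
  bools false = there (here refl)

  matrix : ∀ {n} → Tournament n → Vec (Vec Bool n) n
  matrix T = tabulate λ u → tabulate (edge T u)

  lookup-matrix : ∀ {n} (T : Tournament n) u v → lookup (lookup (matrix T) u) v ≡ edge T u v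
  lookup-matrix T u v =
    trans (cong (λ r → lookup r v) (lookup∘tabulate _ u)) (lookup∘tabulate (edge T u) v)

  orient-matrix : ∀ {n} (T : Tournament n) u v → edge (orient (matrix T)) u v ≡ edge T u v
  orient-matrix T u v with <-cmp u v
  ... | tri< _ _ _    = lookup-matrix T u v
  ... | tri≈ _ refl _ = sym (Tournament.noLoop T u)
  ... | tri> _ u≢v _  = trans (cong not (lookup-matrix T v u))
                          (sym (Tournament.exactlyOne T v u (u≢v ∘ sym)))

  IsCycle-resp : ∀ {n} (S T : Tournament n) → (∀ u v → edge S u v ≡ edge T u v) →
                 ∀ vs → IsCycle S vs → IsCycle T vs
  IsCycle-resp S T eq (v ∷ vs) (uq , l) =
    uq , Linked.map (λ {u} {w} → trans (sym (eq u w))) l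

  numCycles-cong : ∀ {n} (S T : Tournament n) → (∀ u v → edge S u v ≡ edge T u v) →
                   ∀ k → numCycles S k ≡ numCycles T k
  numCycles-cong {n} S T eq k = cong length (filter-≐ (isRep? S) (isRep? T)
    ( (λ {vs} (p , q) → IsCycle-resp S T eq (toList vs) p , q)
    , (λ {vs} (p , q) → IsCycle-resp T S (λ u v → sym (eq u v)) (toList vs) p , q))
    (vectors (allFin n) k))

maxCycles-attained : ∀ n k → ∃[ T ] numCycles {n} T k ≡ maxCycles n k
maxCycles-attained n k = _ , refl

maxCycles-upper : ∀ {n} (T : Tournament n) k → numCycles T k ℕ.≤ maxCycles n k
maxCycles-upper {n} T k = subst (ℕ._≤ maxCycles n k)
  (numCycles-cong (orient (matrix T)) T (orient-matrix T) k)
  (All.lookup (f[xs]≤f[argmax] {f = λ S → numCycles S k} (transitive n) (tournaments n))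
    (∈-map⁺ orient (vectors-complete (vectors-complete bools) (matrix T))))

expected5Cycles : ℕ → ℚ
expected5Cycles n = ℤ.+ 3 / 4 * (ℤ.+ (n C 5) / 1)

expected5Cycles-nonZero : ∀ {n} → 5 ℕ.≤ n → ℚ.NonZero (expected5Cycles n)
expected5Cycles-nonZero {n} 5≤n = ℚ.pos⇒nonZero (expected5Cycles n)
  {{ℚ.pos*pos⇒pos (ℤ.+ 3 / 4) (ℤ.+ (n C 5) / 1) {{pos}}}}
  where
  instance
    _ = 5 !* (n ℕ.∸ 5) !≢0
    _ = n !≢0
    nC5≢0 : ℕ.NonZero (n C 5)
    nC5≢0 = ℕ.>-nonZero (subst (0 ℕ.<_) (sym (nCk≡n!/k![n-k]! 5≤n))
      (m≥n⇒m/n>0 (∣⇒≤ (k![n∸k]!∣n! 5≤n))))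
    pos : ℚ.Positive (ℤ.+ (n C 5) / 1)
    pos = ℚ.normalize-pos (n C 5) 1

-- Defined only for n ≥ 5, since C(n,5) = 0 otherwise.
ratio : ∀ n → 5 ℕ.≤ n → ℚ
ratio n 5≤n = ((ℤ.+ maxCycles n 5 / 1) ÷ expected5Cycles n) {{expected5Cycles-nonZero 5≤n}}

-- lim a(n) = L for a sequence of rationals indexed by n ≥ n₀; rational ε
-- suffice as every positive real exceeds a positive rational.
Limit : (n₀ : ℕ) → (∀ n → n₀ ℕ.≤ n → ℚ) → ℚ → Set
Limit n₀ a L = ∀ ε → 0ℚ ℚ.< ε →
  ∃[ N ] ∀ n (n₀≤n : n₀ ℕ.≤ n) → N ℕ.≤ n → ∣ a n n₀≤n - L ∣ ℚ.< ε

{-# OPTIONS --safe #-}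
module Submission where

-- A closed 5-walk in a tournament has no repeated vertex, since repeating one
-- would split off a loop or a 2-cycle; so 5 c(T,5) counts closed 5-walks.
-- Let S be the skew-symmetric matrix with s(u,v) = 1 when u → v.  Up to the O(n⁴)
-- tuples with two consecutive equal vertices, 32 times this count is the trace
-- of (J + S)⁵, and skew symmetry leaves
--   tr (J + S)⁵ = n⁵ − 5 n² |S𝟏|² + 5 |S²𝟏|².
-- As |s| ≤ 1, |S²𝟏|² ≤ n² |S𝟏|², so the trace is at most n⁵; conversely it is at
-- least n⁵ − 5 n³ for a tournament whose row sums S𝟏 all lie in {−1, 0, 1}.
-- Both bounds agree with 160 · ¾ C(n,5) up to O(n⁴).

open import Defs
open import Algebra.Properties.Semiring.Sum as Sum using ()
open import Data.Bool using (Bool; true; false; not)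
open import Data.Bool.Properties using (not-involutive)
open import Data.Fin using (Fin; zero; suc)
open import Data.Fin.Properties using (_≟_; <-asym)
open import Data.Integer as ℤ using (ℤ; +_; 0ℤ; 1ℤ; _+_; _*_; -_; _-_; _≤_; _<_; _^_)
import Data.Integer.Properties as ℤ
open import Data.Integer.Tactic.RingSolver using (solve-∀)
open import Data.List as List using (List; []; _∷_; length; filter; allFin; map; cartesianProductWith)
open import Data.List.Properties using (length-++; filter-++)
open import Data.List.Relation.Unary.All using ([]; _∷_)
open import Data.List.Relation.Unary.AllPairs using ([]; _∷_)
open import Data.List.Relation.Unary.Linked using ([-]; _∷_)
open import Data.Nat as ℕ using (ℕ; zero; suc; z≤n; s≤s; _!)
open import Data.Nat.Combinatorics using (_C_; nCk≡n!/k![n-k]!; k![n∸k]!∣n!)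
open import Data.Nat.DivMod using (m/n*n≡m)
import Data.Nat.Properties as ℕ
import Data.Nat.Tactic.RingSolver as ℕ-Solver
open import Data.Product using (_×_; _,_)
open import Data.Rational as ℚ using (ℚ; 0ℚ; 1ℚ; _/_; ↥_; ↧_; ↧ₙ_)
import Data.Rational.Properties as ℚ
open import Data.Rational.Unnormalised as ℚᵘ using (mkℚᵘ; *≡*; *<*)
import Data.Rational.Unnormalised.Properties as ℚᵘ
open import Data.Sum using (_⊎_; inj₁; inj₂)
open import Data.Vec using (Vec; []; _∷_; _∷ʳ_; reverse; toList)
open import Data.Vec.Properties using (reverse-∷)
open import Function using (_∘_)
open import Relation.Binary.PropositionalEquality
open import Relation.Nullary using (¬_; Dec; yes; no; does; contradiction)
open import Relation.Unary using (Decidable)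
open import Algebra.Properties.Group ℚ.+-0-group using (⁻¹-involutive)
open Sum ℤ.+-*-semiring
  using (sum; sum-cong-≗; ∑-distrib-+; ∑-comm; *-distribˡ-sum; *-distribʳ-sum)

-- Sums over tuples of vertices

private variable n : ℕ

sum-mono : {f g : Fin n → ℤ} → (∀ i → f i ≤ g i) → sum f ≤ sum g
sum-mono {zero}  f≤g = ℤ.≤-refl
sum-mono {suc n} f≤g = ℤ.+-mono-≤ (f≤g zero) (sum-mono (f≤g ∘ suc))

sum-const : ∀ n c → sum {n} (λ _ → c) ≡ + n * c
sum-const zero    c = sym (ℤ.*-zeroˡ c)
sum-const (suc n) c = trans (cong (_+_ c) (sum-const n c)) (sym (ℤ.suc-* (+ n) c))

∑ⁿ : ∀ k → (Vec (Fin n) k → ℤ) → ℤ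
∑ⁿ zero    f = f []
∑ⁿ (suc k) f = sum λ i → ∑ⁿ k (f ∘ (i ∷_))

∑ⁿ-cong : ∀ k {f g : Vec (Fin n) k → ℤ} → (∀ v → f v ≡ g v) → ∑ⁿ k f ≡ ∑ⁿ k g
∑ⁿ-cong zero    f≗g = f≗g []
∑ⁿ-cong (suc k) f≗g = sum-cong-≗ λ i → ∑ⁿ-cong k (f≗g ∘ (i ∷_))

∑ⁿ-mono : ∀ k {f g : Vec (Fin n) k → ℤ} → (∀ v → f v ≤ g v) → ∑ⁿ k f ≤ ∑ⁿ k g
∑ⁿ-mono zero    f≤g = f≤g []
∑ⁿ-mono (suc k) f≤g = sum-mono λ i → ∑ⁿ-mono k (f≤g ∘ (i ∷_))

∑ⁿ-+ : ∀ k (f g : Vec (Fin n) k → ℤ) → ∑ⁿ k (λ v → f v + g v) ≡ ∑ⁿ k f + ∑ⁿ k g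
∑ⁿ-+ zero    f g = refl
∑ⁿ-+ (suc k) f g = trans (sum-cong-≗ λ i → ∑ⁿ-+ k (f ∘ (i ∷_)) (g ∘ (i ∷_)))
  (∑-distrib-+ (λ i → ∑ⁿ k (f ∘ (i ∷_))) λ i → ∑ⁿ k (g ∘ (i ∷_)))

∑ⁿ-* : ∀ k c (f : Vec (Fin n) k → ℤ) → ∑ⁿ k (λ v → c * f v) ≡ c * ∑ⁿ k f
∑ⁿ-* zero    c f = refl
∑ⁿ-* (suc k) c f =
  trans (sum-cong-≗ λ i → ∑ⁿ-* k c (f ∘ (i ∷_))) (sym (*-distribˡ-sum c λ i → ∑ⁿ k (f ∘ (i ∷_))))

∑ⁿ-const : ∀ n k c → ∑ⁿ {n} k (λ _ → c) ≡ (+ n) ^ k * c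
∑ⁿ-const n zero    c = sym (ℤ.*-identityˡ c)
∑ⁿ-const n (suc k) c = trans (sum-cong-≗ {n} λ _ → ∑ⁿ-const n k c)
  (trans (sum-const n _) (sym (ℤ.*-assoc (+ n) ((+ n) ^ k) c)))

-- Exchange of summation carries the last coordinate outwards one level at a time. Rotation
-- invariance is this identity read backwards, and reversal invariance follows from it by induction.
∑ⁿ-∷ʳ : ∀ k (f : Vec (Fin n) (suc k) → ℤ) → ∑ⁿ (suc k) f ≡ sum λ i → ∑ⁿ k λ v → f (v ∷ʳ i)
∑ⁿ-∷ʳ zero    f = refl
∑ⁿ-∷ʳ (suc k) f = trans (sum-cong-≗ λ i → ∑ⁿ-∷ʳ k (f ∘ (i ∷_)))
  (∑-comm λ i j → ∑ⁿ k λ v → f (i ∷ (v ∷ʳ j)))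

∑ⁿ-reverse : ∀ k (f : Vec (Fin n) k → ℤ) → ∑ⁿ k (f ∘ reverse) ≡ ∑ⁿ k f
∑ⁿ-reverse zero    f = refl
∑ⁿ-reverse (suc k) f = trans
  (sum-cong-≗ λ i → trans (∑ⁿ-cong k λ v → cong f (reverse-∷ i v)) (∑ⁿ-reverse k (f ∘ (_∷ʳ i))))
  (sym (∑ⁿ-∷ʳ k f))

rotate : ∀ {A : Set} {k} → Vec A k → Vec A k
rotate []      = []
rotate (x ∷ v) = v ∷ʳ x

∑ⁿ-rotate : ∀ k (f : Vec (Fin n) k → ℤ) → ∑ⁿ k (f ∘ rotate) ≡ ∑ⁿ k f
∑ⁿ-rotate zero    f = refl
∑ⁿ-rotate (suc k) f = sym (∑ⁿ-∷ʳ k f)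

-- The sum along the orbit of the cyclic shift. It has three uses: to collect sign monomials of one
-- shape, to pass from a representative of a cycle to all its starting points, and to look for a
-- repetition at each step of a closed walk.
rotations : (Vec (Fin n) 5 → ℤ) → Vec (Fin n) 5 → ℤ
rotations f v = f v + f (rotate v) + f (rotate (rotate v)) + f (rotate (rotate (rotate v)))
  + f (rotate (rotate (rotate (rotate v))))

∑ⁿ-rotations : ∀ (f : Vec (Fin n) 5 → ℤ) → ∑ⁿ 5 (rotations f) ≡ + 5 * ∑ⁿ 5 f
∑ⁿ-rotations f = begin
  ∑ⁿ 5 (rotations f)
    ≡⟨ ∑ⁿ-+ 5 (λ v → f v + f (ρ v) + f (ρ (ρ v)) + f (ρ (ρ (ρ v)))) (f ∘ ρ ∘ ρ ∘ ρ ∘ ρ) ⟩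
  ∑ⁿ 5 (λ v → f v + f (ρ v) + f (ρ (ρ v)) + f (ρ (ρ (ρ v)))) + ∑ⁿ 5 (f ∘ ρ ∘ ρ ∘ ρ ∘ ρ)
    ≡⟨ cong₂ _+_ (trans (∑ⁿ-+ 5 (λ v → f v + f (ρ v) + f (ρ (ρ v))) (f ∘ ρ ∘ ρ ∘ ρ)) (cong₂ _+_
         (trans (∑ⁿ-+ 5 (λ v → f v + f (ρ v)) (f ∘ ρ ∘ ρ)) (cong₂ _+_
           (trans (∑ⁿ-+ 5 f (f ∘ ρ)) (cong (_+_ (∑ⁿ 5 f)) r₁)) r₂)) r₃)) r₄ ⟩
  ∑ⁿ 5 f + ∑ⁿ 5 f + ∑ⁿ 5 f + ∑ⁿ 5 f + ∑ⁿ 5 f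
    ≡⟨ five (∑ⁿ 5 f) ⟩
  + 5 * ∑ⁿ 5 f ∎
  where
  open ≡-Reasoning
  ρ : Vec (Fin _) 5 → Vec (Fin _) 5
  ρ = rotate
  r₁ = ∑ⁿ-rotate 5 f
  r₂ = trans (∑ⁿ-rotate 5 (f ∘ ρ)) r₁
  r₃ = trans (∑ⁿ-rotate 5 (f ∘ ρ ∘ ρ)) r₂
  r₄ = trans (∑ⁿ-rotate 5 (f ∘ ρ ∘ ρ ∘ ρ)) r₃
  five : ∀ x → x + x + x + x + x ≡ + 5 * x
  five = solve-∀

-- The trace of (J + S)⁵

i≡-i⇒i≡0 : ∀ i → i ≡ - i → i ≡ 0ℤ
i≡-i⇒i≡0 (+ zero) _ = refl

⟪_,_⟫ : (Fin n → ℤ) → (Fin n → ℤ) → ℤ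
⟪ f , g ⟫ = sum λ i → f i * g i

module Skew {n} (s : Fin n → Fin n → ℤ) (skew : ∀ a b → s b a ≡ - s a b) where

  open ≡-Reasoning

  N : ℤ
  N = + n

  S : (Fin n → ℤ) → Fin n → ℤ
  S f a = ⟪ s a , f ⟫

  𝟏 : Fin n → ℤ
  𝟏 _ = 1ℤ

  -- The transpose of `S` is its negative: exchange the two sums, then replace `s a b` by `- s b a`.
  adjoint : ∀ f g → ⟪ f , S g ⟫ ≡ - ⟪ S f , g ⟫
  adjoint f g = begin
    sum (λ a → f a * sum λ b → s a b * g b)
      ≡⟨ sum-cong-≗ (λ a → *-distribˡ-sum (f a) λ b → s a b * g b) ⟩
    sum (λ a → sum λ b → f a * (s a b * g b))
      ≡⟨ ∑-comm (λ a b → f a * (s a b * g b)) ⟩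
    sum (λ b → sum λ a → f a * (s a b * g b))
      ≡⟨ sum-cong-≗ (λ b → trans (sum-cong-≗ λ a → trans (cong (λ x → f a * (x * g b)) (skew b a))
           (move (f a) (s b a) (g b))) (sym (*-distribʳ-sum (- g b) λ a → s b a * f a))) ⟩
    sum (λ b → S f b * - g b)
      ≡⟨ sum-cong-≗ (λ b → neg (S f b) (g b)) ⟩
    sum (λ b → - 1ℤ * (S f b * g b))
      ≡⟨ *-distribˡ-sum (- 1ℤ) (λ b → S f b * g b) ⟨
    - 1ℤ * ⟪ S f , g ⟫
      ≡⟨ ℤ.-1*i≡-i _ ⟩
    - ⟪ S f , g ⟫ ∎
    where
    move : ∀ x y z → x * (- y * z) ≡ y * x * - z
    move = solve-∀
    neg : ∀ x y → x * - y ≡ - 1ℤ * (x * y)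
    neg = solve-∀

  ⟪⟫-comm : ∀ (f g : Fin n → ℤ) → ⟪ f , g ⟫ ≡ ⟪ g , f ⟫
  ⟪⟫-comm f g = sum-cong-≗ λ a → ℤ.*-comm (f a) (g a)

  ⟨𝟏,⟩ : ∀ f → ⟪ 𝟏 , f ⟫ ≡ sum f
  ⟨𝟏,⟩ f = sum-cong-≗ (ℤ.*-identityˡ ∘ f)

  S𝟏 : ∀ a → S 𝟏 a ≡ sum (s a)
  S𝟏 a = sum-cong-≗ (ℤ.*-identityʳ ∘ s a)

  ⟨𝟏,S𝟏⟩≡0 : ⟪ 𝟏 , S 𝟏 ⟫ ≡ 0ℤ
  ⟨𝟏,S𝟏⟩≡0 = i≡-i⇒i≡0 _ (trans (adjoint 𝟏 𝟏) (cong -_ (⟪⟫-comm (S 𝟏) 𝟏)))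

  -- `walk` is the product of the entries of J + S along the closed walk a, b, c, d, e, a. Its
  -- monomials of degrees two and four are the rotations of `wedge` (two adjacent steps), `matching`
  -- (two disjoint steps) and `path` (all steps but one). All take five vertices so that they can be
  -- rotated; each vertex absent from a monomial contributes a factor n to its sum.
  wedge matching path walk : Vec (Fin n) 5 → ℤ
  wedge    (a ∷ b ∷ c ∷ d ∷ e ∷ []) = s a b * s b c
  matching (a ∷ b ∷ c ∷ d ∷ e ∷ []) = s a b * s c d
  path     (a ∷ b ∷ c ∷ d ∷ e ∷ []) = s a b * (s b c * (s c d * s d e))
  walk     (a ∷ b ∷ c ∷ d ∷ e ∷ []) =
    (1ℤ + s a b) * (1ℤ + s b c) * (1ℤ + s c d) * (1ℤ + s d e) * (1ℤ + s e a)

  -- The free vertices d and e give n²; the rest is ⟨𝟏, S²𝟏⟩, which `adjoint` turns into a negated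
  -- square norm.
  ∑ⁿ-wedge : ∑ⁿ 5 wedge ≡ - (N * (N * ⟪ S 𝟏 , S 𝟏 ⟫))
  ∑ⁿ-wedge = begin
    ∑ⁿ 5 wedge
      ≡⟨ sum-cong-≗ (λ a → sum-cong-≗ λ b → sum-cong-≗ λ c →
           trans (∑ⁿ-const n 2 (s a b * s b c)) (swap² N (s a b) (s b c))) ⟩
    sum (λ a → sum λ b → sum λ c → s a b * (s b c * (N * N)))
      ≡⟨ sum-cong-≗ (λ a → sum-cong-≗ λ b → trans
           (sym (*-distribˡ-sum (s a b) λ c → s b c * (N * N)))
           (cong (s a b *_) (trans (sym (*-distribʳ-sum (N * N) (s b)))
             (cong (_* (N * N)) (sym (S𝟏 b)))))) ⟩
    sum (λ a → sum λ b → s a b * (S 𝟏 b * (N * N)))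
      ≡⟨ sum-cong-≗ (λ a → trans (sum-cong-≗ λ b → sym (ℤ.*-assoc (s a b) (S 𝟏 b) (N * N)))
           (sym (*-distribʳ-sum (N * N) λ b → s a b * S 𝟏 b))) ⟩
    sum (λ a → S (S 𝟏) a * (N * N))
      ≡⟨ *-distribʳ-sum (N * N) (S (S 𝟏)) ⟨
    sum (S (S 𝟏)) * (N * N)
      ≡⟨ cong (_* (N * N)) (trans (sym (⟨𝟏,⟩ (S (S 𝟏)))) (adjoint 𝟏 (S 𝟏))) ⟩
    - ⟪ S 𝟏 , S 𝟏 ⟫ * (N * N)
      ≡⟨ last ⟪ S 𝟏 , S 𝟏 ⟫ N ⟩
    - (N * (N * ⟪ S 𝟏 , S 𝟏 ⟫)) ∎
    where
    swap² : ∀ m x y → m * (m * 1ℤ) * (x * y) ≡ x * (y * (m * m))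
    swap² = solve-∀
    last : ∀ x m → - x * (m * m) ≡ - (m * (m * x))
    last = solve-∀

  -- The two factors share no vertex, so the sum splits as n times the square of the total of `s`,
  -- and skew symmetry makes that total vanish.
  ∑ⁿ-matching : ∑ⁿ 5 matching ≡ 0ℤ
  ∑ⁿ-matching = begin
    ∑ⁿ 5 matching
      ≡⟨ sum-cong-≗ (λ a → sum-cong-≗ λ b → inner (s a b)) ⟩
    sum (λ a → sum λ b → s a b * (Z * N))
      ≡⟨ sum-cong-≗ (λ a → *-distribʳ-sum (Z * N) (s a)) ⟨
    sum (λ a → sum (s a) * (Z * N))
      ≡⟨ *-distribʳ-sum (Z * N) (λ a → sum (s a)) ⟨
    Z * (Z * N)
      ≡⟨ cong (_* (Z * N)) Z≡0 ⟩
    0ℤ ∎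
    where
    Z : ℤ
    Z = sum λ a → sum (s a)
    Z≡0 : Z ≡ 0ℤ
    Z≡0 = trans (sum-cong-≗ (sym ∘ S𝟏)) (trans (sym (⟨𝟏,⟩ (S 𝟏))) ⟨𝟏,S𝟏⟩≡0)
    swap : ∀ m x y → m * (x * y) ≡ x * m * y
    swap = solve-∀
    comm : ∀ m x z → x * m * z ≡ x * (z * m)
    comm = solve-∀
    inner : ∀ x → sum (λ c → sum λ d → sum {n} λ _ → x * s c d) ≡ x * (Z * N)
    inner x = begin
      sum (λ c → sum λ d → sum {n} λ _ → x * s c d)
        ≡⟨ sum-cong-≗ (λ c → trans
             (sum-cong-≗ λ d → trans (sum-const n (x * s c d)) (swap N x (s c d)))
             (sym (*-distribˡ-sum (x * N) (s c)))) ⟩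
      sum (λ c → x * N * sum (s c))
        ≡⟨ *-distribˡ-sum (x * N) (λ c → sum (s c)) ⟨
      x * N * Z
        ≡⟨ comm N x Z ⟩
      x * (Z * N) ∎

  -- Summing from the last vertex inwards builds ⟨𝟏, S⁴𝟏⟩; moving `S` across twice costs two signs,
  -- which cancel.
  ∑ⁿ-path : ∑ⁿ 5 path ≡ ⟪ S (S 𝟏) , S (S 𝟏) ⟫
  ∑ⁿ-path = begin
    ∑ⁿ 5 path
      ≡⟨ sum-cong-≗ (λ a → sum-cong-≗ λ b → trans (sum-cong-≗ λ c → trans (sum-cong-≗ λ d →
           trans (factor (s a b) (s b c) (s c d) (s d))
             (cong (λ r → s a b * (s b c * (s c d * r))) (sym (S𝟏 d))))
           (step₂ (s a b) (s b c) (s c) (S 𝟏)))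
           (step₁ (s a b) (s b) (S (S 𝟏)))) ⟩
    sum (S (S (S (S 𝟏))))
      ≡⟨ trans (sym (⟨𝟏,⟩ (S (S (S (S 𝟏)))))) (adjoint 𝟏 (S (S (S 𝟏)))) ⟩
    - ⟪ S 𝟏 , S (S (S 𝟏)) ⟫
      ≡⟨ cong -_ (adjoint (S 𝟏) (S (S 𝟏))) ⟩
    - - ⟪ S (S 𝟏) , S (S 𝟏) ⟫
      ≡⟨ ℤ.neg-involutive _ ⟩
    ⟪ S (S 𝟏) , S (S 𝟏) ⟫ ∎
    where
    step₁ : ∀ x (f g : Fin n → ℤ) → sum (λ i → x * (f i * g i)) ≡ x * ⟪ f , g ⟫
    step₁ x f g = sym (*-distribˡ-sum x λ i → f i * g i)
    step₂ : ∀ x y (f g : Fin n → ℤ) → sum (λ i → x * (y * (f i * g i))) ≡ x * (y * ⟪ f , g ⟫)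
    step₂ x y f g = trans (sym (*-distribˡ-sum x λ i → y * (f i * g i))) (cong (x *_) (step₁ y f g))
    factor : ∀ x y z (f : Fin n → ℤ) → sum (λ i → x * (y * (z * f i))) ≡ x * (y * (z * sum f))
    factor x y z f = trans (sym (*-distribˡ-sum x λ i → y * (z * f i)))
      (cong (x *_) (trans (sym (*-distribˡ-sum y λ i → z * f i)) (cong (y *_) (sym (*-distribˡ-sum z f)))))

  -- Reversing a closed walk negates all its signs, so adding the reverse kills
  -- the products of odd degree.
  walk+reverse : ∀ v → walk v + walk (reverse v) ≡
    + 2 * (1ℤ + rotations wedge v + rotations matching v + rotations path v)
  walk+reverse (a ∷ b ∷ c ∷ d ∷ e ∷ [])
    rewrite skew d e | skew c d | skew b c | skew a b | skew e a =
    even (s a b) (s b c) (s c d) (s d e) (s e a)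
    where
    even : ∀ x y z w v →
      (1ℤ + x) * (1ℤ + y) * (1ℤ + z) * (1ℤ + w) * (1ℤ + v) +
      (1ℤ + - w) * (1ℤ + - z) * (1ℤ + - y) * (1ℤ + - x) * (1ℤ + - v) ≡
      + 2 * (1ℤ + (x * y + y * z + z * w + w * v + v * x)
                + (x * z + y * w + z * v + w * x + v * y)
                + (x * (y * (z * w)) + y * (z * (w * v)) + z * (w * (v * x))
                   + w * (v * (x * y)) + v * (x * (y * z))))
    even = solve-∀

  ∑ⁿ-walk : ∑ⁿ 5 walk ≡ N ^ 5 - + 5 * (N * (N * ⟪ S 𝟏 , S 𝟏 ⟫)) + + 5 * ⟪ S (S 𝟏) , S (S 𝟏) ⟫
  -- Doubling makes room for the reversed walk: reversal permutes the tuples, so both copies of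
  -- `walk` have the same sum.
  ∑ⁿ-walk = ℤ.*-cancelˡ-≡ (+ 2) _ _ (begin
    + 2 * ∑ⁿ 5 walk
      ≡⟨ two (∑ⁿ 5 walk) ⟩
    ∑ⁿ 5 walk + ∑ⁿ 5 walk
      ≡⟨ cong (_+_ (∑ⁿ 5 walk)) (sym (∑ⁿ-reverse 5 walk)) ⟩
    ∑ⁿ 5 walk + ∑ⁿ 5 (walk ∘ reverse)
      ≡⟨ ∑ⁿ-+ 5 walk (walk ∘ reverse) ⟨
    ∑ⁿ 5 (λ v → walk v + walk (reverse v))
      ≡⟨ ∑ⁿ-cong 5 walk+reverse ⟩
    ∑ⁿ 5 (λ v → + 2 * (1ℤ + rotations wedge v + rotations matching v + rotations path v))
      ≡⟨ ∑ⁿ-* 5 (+ 2) (λ v → 1ℤ + rotations wedge v + rotations matching v + rotations path v) ⟩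
    + 2 * ∑ⁿ 5 (λ v → 1ℤ + rotations wedge v + rotations matching v + rotations path v)
      ≡⟨ cong (+ 2 *_) (trans (∑ⁿ-+ 5 (λ v → 1ℤ + rotations wedge v + rotations matching v) (rotations path))
         (cong₂ _+_
           (trans (∑ⁿ-+ 5 (λ v → 1ℤ + rotations wedge v) (rotations matching)) (cong₂ _+_
             (trans (∑ⁿ-+ 5 (λ _ → 1ℤ) (rotations wedge)) (cong₂ _+_ (∑ⁿ-const n 5 1ℤ)
               (trans (∑ⁿ-rotations wedge) (cong (+ 5 *_) ∑ⁿ-wedge))))
             (trans (∑ⁿ-rotations matching) (cong (+ 5 *_) ∑ⁿ-matching))))
           (trans (∑ⁿ-rotations path) (cong (+ 5 *_) ∑ⁿ-path)))) ⟩
    + 2 * (N ^ 5 * 1ℤ + + 5 * - X + + 5 * 0ℤ + + 5 * Y)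
      ≡⟨ cong (+ 2 *_) (tidy (N ^ 5) X Y) ⟩
    + 2 * (N ^ 5 - + 5 * X + + 5 * Y) ∎)
    where
    X Y : ℤ
    X = N * (N * ⟪ S 𝟏 , S 𝟏 ⟫)
    Y = ⟪ S (S 𝟏) , S (S 𝟏) ⟫
    two : ∀ x → + 2 * x ≡ x + x
    two = solve-∀
    tidy : ∀ p x y → p * 1ℤ + + 5 * - x + + 5 * 0ℤ + + 5 * y ≡ p - + 5 * x + + 5 * y
    tidy = solve-∀

-- Cauchy-Schwarz and the two bounds on the trace

0≤i² : ∀ i → 0ℤ ≤ i * i
0≤i² (+ m)      = subst (0ℤ ≤_) (sym (ℤ.+◃n≡+n (m ℕ.* m))) (ℤ.+≤+ ℕ.z≤n)
0≤i² ℤ.-[1+ m ] = ℤ.+≤+ ℕ.z≤n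

-- Cauchy-Schwarz against the all-ones vector. Doubled, the left side is a double sum of terms 2xy,
-- each at most x² + y² because (x - y)² ≥ 0.
sum-square-≤ : ∀ (f : Fin n → ℤ) → sum f * sum f ≤ + n * ⟪ f , f ⟫
sum-square-≤ {n} f = ℤ.*-cancelˡ-≤-pos _ _ (+ 2) (begin
  + 2 * (sum f * sum f)
    ≡⟨ ℤ.*-assoc (+ 2) (sum f) (sum f) ⟨
  + 2 * sum f * sum f
    ≡⟨ *-distribˡ-sum (+ 2 * sum f) f ⟩
  sum (λ i → + 2 * sum f * f i)
    ≡⟨ sum-cong-≗ (λ i → trans (move (sum f) (f i)) (*-distribˡ-sum (+ 2 * f i) f)) ⟩
  sum (λ i → sum λ j → + 2 * f i * f j)
    ≤⟨ sum-mono (λ i → sum-mono λ j → amgm (f i) (f j)) ⟩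
  sum (λ i → sum λ j → f i * f i + f j * f j)
    ≡⟨ sum-cong-≗ (λ i → trans (∑-distrib-+ (λ _ → f i * f i) (λ j → f j * f j))
         (cong (_+ ⟪ f , f ⟫) (sum-const n (f i * f i)))) ⟩
  sum (λ i → + n * (f i * f i) + ⟪ f , f ⟫)
    ≡⟨ trans (∑-distrib-+ (λ i → + n * (f i * f i)) (λ _ → ⟪ f , f ⟫)) (cong₂ _+_
         (sym (*-distribˡ-sum (+ n) λ i → f i * f i)) (sum-const n ⟪ f , f ⟫)) ⟩
  + n * ⟪ f , f ⟫ + + n * ⟪ f , f ⟫
    ≡⟨ two (+ n * ⟪ f , f ⟫) ⟩
  + 2 * (+ n * ⟪ f , f ⟫) ∎)
  where
  open ℤ.≤-Reasoning
  move : ∀ x y → + 2 * x * y ≡ + 2 * y * x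
  move = solve-∀
  two : ∀ x → x + x ≡ + 2 * x
  two = solve-∀
  square : ∀ x y → (x - y) * (x - y) ≡ x * x + y * y - + 2 * x * y
  square = solve-∀
  amgm : ∀ x y → + 2 * x * y ≤ x * x + y * y
  amgm x y = ℤ.0≤i-j⇒j≤i (subst (0ℤ ≤_) (square x y) (0≤i² (x - y)))

module Bounded {n} (s : Fin n → Fin n → ℤ) (skew : ∀ a b → s b a ≡ - s a b)
  (bounded : ∀ a b → s a b * s a b ≤ 1ℤ) where

  open Skew s skew
  open ℤ.≤-Reasoning

  -- `S` has operator norm at most n: Cauchy-Schwarz in each row, whose squared entries are at most
  -- 1, and then n rows.
  S-bounded : ∀ f → ⟪ S f , S f ⟫ ≤ N * (N * ⟪ f , f ⟫)
  S-bounded f = begin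
    ⟪ S f , S f ⟫
      ≤⟨ sum-mono (λ a → ℤ.≤-trans (sum-square-≤ λ b → s a b * f b)
           (ℤ.*-monoˡ-≤-nonNeg N (sum-mono λ b → shrink a b (f b)))) ⟩
    sum {n} (λ _ → N * ⟪ f , f ⟫)
      ≡⟨ sum-const n (N * ⟪ f , f ⟫) ⟩
    N * (N * ⟪ f , f ⟫) ∎
    where
    regroup : ∀ x y → x * y * (x * y) ≡ x * x * (y * y)
    regroup = solve-∀
    shrink : ∀ a b y → s a b * y * (s a b * y) ≤ y * y
    shrink a b y = begin
      s a b * y * (s a b * y)   ≡⟨ regroup (s a b) y ⟩
      s a b * s a b * (y * y)   ≤⟨ ℤ.*-monoʳ-≤-nonNeg (y * y) {{ℤ.nonNegative (0≤i² y)}} (bounded a b) ⟩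
      1ℤ * (y * y)              ≡⟨ ℤ.*-identityˡ (y * y) ⟩
      y * y                     ∎

  -- The positive correction 5 |S²𝟏|² is absorbed by the negative one, by `S-bounded` at `S 𝟏`.
  ∑ⁿ-walk-upper : ∑ⁿ 5 walk ≤ N ^ 5
  ∑ⁿ-walk-upper = begin
    ∑ⁿ 5 walk
      ≡⟨ ∑ⁿ-walk ⟩
    N ^ 5 - + 5 * X + + 5 * ⟪ S (S 𝟏) , S (S 𝟏) ⟫
      ≤⟨ ℤ.+-monoʳ-≤ (N ^ 5 - + 5 * X) (ℤ.*-monoˡ-≤-nonNeg (+ 5) (S-bounded (S 𝟏))) ⟩
    N ^ 5 - + 5 * X + + 5 * X
      ≡⟨ cancel (N ^ 5) (+ 5 * X) ⟩
    N ^ 5 ∎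
    where
    X : ℤ
    X = N * (N * ⟪ S 𝟏 , S 𝟏 ⟫)
    cancel : ∀ p x → p - x + x ≡ p
    cancel = solve-∀

  -- The term |S²𝟏|² is dropped as nonnegative, and |S𝟏|² is at most n, one for each row, so the
  -- loss is at most 5 n² · n.
  ∑ⁿ-walk-lower : (∀ a → S 𝟏 a * S 𝟏 a ≤ 1ℤ) → N ^ 5 ≤ ∑ⁿ 5 walk + + 5 * N ^ 3
  ∑ⁿ-walk-lower small = begin
    N ^ 5
      ≡⟨ split (N ^ 5) X ⟩
    N ^ 5 - + 5 * X + + 5 * 0ℤ + + 5 * X
      ≤⟨ ℤ.+-mono-≤
           (ℤ.+-monoʳ-≤ (N ^ 5 - + 5 * X) (ℤ.*-monoˡ-≤-nonNeg (+ 5) 0≤Y))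
           (ℤ.*-monoˡ-≤-nonNeg (+ 5) (ℤ.*-monoˡ-≤-nonNeg N (ℤ.*-monoˡ-≤-nonNeg N
             (ℤ.≤-trans (sum-mono small) (ℤ.≤-reflexive (sum-const n 1ℤ)))))) ⟩
    N ^ 5 - + 5 * X + + 5 * Y + + 5 * (N * (N * (N * 1ℤ)))
      ≡⟨ cong (_+ + 5 * N ^ 3) ∑ⁿ-walk ⟨
    ∑ⁿ 5 walk + + 5 * N ^ 3 ∎
    where
    X Y : ℤ
    X = N * (N * ⟪ S 𝟏 , S 𝟏 ⟫)
    Y = ⟪ S (S 𝟏) , S (S 𝟏) ⟫
    0≤Y : 0ℤ ≤ Y
    0≤Y = begin
      0ℤ                ≡⟨ ℤ.*-zeroʳ N ⟨
      N * 0ℤ            ≡⟨ sum-const n 0ℤ ⟨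
      sum {n} (λ _ → 0ℤ) ≤⟨ sum-mono (λ a → 0≤i² (S (S 𝟏) a)) ⟩
      Y                 ∎
    split : ∀ p x → p ≡ p - + 5 * x + + 5 * 0ℤ + + 5 * x
    split = solve-∀

-- Cycles and closed walks of a tournament

bit : Bool → ℕ
bit true  = 1
bit false = 0

𝟙 : {P : Set} → Dec P → ℕ
𝟙 P? = bit (does P?)

𝟙-yes : {P : Set} (P? : Dec P) → P → 𝟙 P? ≡ 1
𝟙-yes (yes _) _ = refl
𝟙-yes (no ¬p) p = contradiction p ¬p

𝟙-no : {P : Set} (P? : Dec P) → ¬ P → 𝟙 P? ≡ 0
𝟙-no (yes p) ¬p = contradiction p ¬p
𝟙-no (no _)  _  = refl

length-filter-map : {A B : Set} {P : B → Set} (P? : Decidable P) (f : A → B) (xs : List A) →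
  length (filter P? (map f xs)) ≡ length (filter (P? ∘ f) xs)
length-filter-map P? f []       = refl
length-filter-map P? f (x ∷ xs) with does (P? (f x))
... | true  = cong suc (length-filter-map P? f xs)
... | false = length-filter-map P? f xs

-- The function `g` is arbitrary because the induction passes to `g ∘ suc`; `allFin n` is the case
-- of the identity.
length-filter-product : {A B C : Set} {P : C → Set} (P? : Decidable P) (f : A → B → C)
  (g : Fin n → A) (ys : List B) →
  + length (filter P? (cartesianProductWith f (List.tabulate g) ys)) ≡
  sum λ i → + length (filter (P? ∘ f (g i)) ys)
length-filter-product {zero}  P? f g ys = refl
length-filter-product {suc n} P? f g ys = begin
  + length (filter P? (map (f (g zero)) ys List.++ rest))
    ≡⟨ cong (+_ ∘ length) (filter-++ P? (map (f (g zero)) ys) rest) ⟩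
  + length (filter P? (map (f (g zero)) ys) List.++ filter P? rest)
    ≡⟨ cong +_ (length-++ (filter P? (map (f (g zero)) ys))) ⟩
  + length (filter P? (map (f (g zero)) ys)) + + length (filter P? rest)
    ≡⟨ cong₂ _+_ (cong +_ (length-filter-map P? (f (g zero)) ys)) (length-filter-product P? f (g ∘ suc) ys) ⟩
  sum (λ i → + length (filter (P? ∘ f (g i)) ys)) ∎
  where
  open ≡-Reasoning
  rest = cartesianProductWith f (List.tabulate (g ∘ suc)) ys

length-filter-vectors : ∀ k {P : Vec (Fin n) k → Set} (P? : Decidable P) →
  + length (filter P? (vectors (allFin n) k)) ≡ ∑ⁿ k (λ v → + 𝟙 (P? v))
length-filter-vectors zero P? with does (P? [])
... | true  = refl
... | false = refl
length-filter-vectors {n} (suc k) P? = trans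
  (length-filter-product P? _∷_ (λ i → i) (vectors (allFin n) k))
  (sum-cong-≗ λ i → length-filter-vectors k (P? ∘ (i ∷_)))

sum-≟ : ∀ (a : Fin n) → sum (λ b → + 𝟙 (a ≟ b)) ≡ 1ℤ
sum-≟ {suc n} zero    = cong (_+_ 1ℤ) (trans (sum-const n 0ℤ) (ℤ.*-zeroʳ (+ n)))
sum-≟ {suc n} (suc a) = trans (ℤ.+-identityˡ _) (sum-≟ a)

-- Marks a degenerate first step; the rotations cover all five steps. The total over all tuples is
-- n⁴, since b is determined by a.
startsTwice : Vec (Fin n) 5 → ℤ
startsTwice (a ∷ b ∷ _) = + 𝟙 (a ≟ b)

∑ⁿ-startsTwice : ∑ⁿ {n} 5 startsTwice ≡ (+ n) ^ 4
∑ⁿ-startsTwice {n} = begin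
  ∑ⁿ {n} 5 startsTwice
    ≡⟨ sum-cong-≗ {n} (λ a → trans (sum-cong-≗ {n} λ b → ∑ⁿ-const n 3 (+ 𝟙 (a ≟ b)))
         (sym (*-distribˡ-sum ((+ n) ^ 3) λ b → + 𝟙 (a ≟ b)))) ⟩
  sum {n} (λ a → (+ n) ^ 3 * sum (λ b → + 𝟙 (a ≟ b)))
    ≡⟨ sum-cong-≗ {n} (λ a → trans (cong ((+ n) ^ 3 *_) (sum-≟ a)) (ℤ.*-identityʳ ((+ n) ^ 3))) ⟩
  sum {n} (λ _ → (+ n) ^ 3)
    ≡⟨ sum-const n ((+ n) ^ 3) ⟩
  (+ n) ^ 4 ∎
  where open ≡-Reasoning

module Cycles {n} (T : Tournament n) where

  open Tournament T

  cyc rep : Vec (Fin n) 5 → ℤ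
  cyc v = + 𝟙 (isCycle? T (toList v))
  rep v = + 𝟙 (isRep? T v)

  IsCycle-rotate : ∀ (v : Vec (Fin n) 5) → IsCycle T (toList v) → IsCycle T (toList (rotate v))
  IsCycle-rotate (a ∷ b ∷ c ∷ d ∷ e ∷ [])
    ( (a≢b ∷ a≢c ∷ a≢d ∷ a≢e ∷ []) ∷ (b≢c ∷ b≢d ∷ b≢e ∷ []) ∷ (c≢d ∷ c≢e ∷ []) ∷ (d≢e ∷ []) ∷ [] ∷ []
    , ab ∷ bc ∷ cd ∷ de ∷ ea ∷ [-] ) =
      (b≢c ∷ b≢d ∷ b≢e ∷ ≢-sym a≢b ∷ []) ∷ (c≢d ∷ c≢e ∷ ≢-sym a≢c ∷ []) ∷ (d≢e ∷ ≢-sym a≢d ∷ []) ∷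
        (≢-sym a≢e ∷ []) ∷ [] ∷ []
    , bc ∷ cd ∷ de ∷ ea ∷ ab ∷ [-]

  -- Rotation has order five, so four more rotations undo one. Matching on all five entries lets the
  -- composite reduce to `v`.
  IsCycle-unrotate : ∀ (v : Vec (Fin n) 5) → IsCycle T (toList (rotate v)) → IsCycle T (toList v)
  IsCycle-unrotate v@(_ ∷ _ ∷ _ ∷ _ ∷ _ ∷ []) =
    IsCycle-rotate (ρ (ρ (ρ (ρ v)))) ∘ IsCycle-rotate (ρ (ρ (ρ v))) ∘
    IsCycle-rotate (ρ (ρ v)) ∘ IsCycle-rotate (ρ v)
    where
    ρ : Vec (Fin n) 5 → Vec (Fin n) 5
    ρ = rotate

  rotations-rotate : ∀ (f : Vec (Fin n) 5 → ℤ) v → rotations f (rotate v) ≡ rotations f v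
  rotations-rotate f v@(_ ∷ _ ∷ _ ∷ _ ∷ _ ∷ []) =
    shift (f v) (f (rotate v)) (f (rotate (rotate v))) (f (rotate (rotate (rotate v))))
      (f (rotate (rotate (rotate (rotate v)))))
    where
    shift : ∀ p q r s t → q + r + s + t + p ≡ p + q + r + s + t
    shift = solve-∀

  -- In every other rotation an entry above `a` comes first, so that rotation is not counted.
  rotations-rep-least : ∀ v → IsCycle T (toList v) → LeastFirst (toList v) → rotations rep v ≡ 1ℤ
  rotations-rep-least v@(a ∷ b ∷ c ∷ d ∷ e ∷ []) cycle least@(a<b ∷ a<c ∷ a<d ∷ a<e ∷ [])
    rewrite 𝟙-yes (isRep? T v) (cycle , least)
    | 𝟙-no (isRep? T (b ∷ c ∷ d ∷ e ∷ a ∷ [])) (λ { (_ , _ ∷ _ ∷ _ ∷ b<a ∷ []) → <-asym a<b b<a })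
    | 𝟙-no (isRep? T (c ∷ d ∷ e ∷ a ∷ b ∷ [])) (λ { (_ , _ ∷ _ ∷ c<a ∷ _ ∷ []) → <-asym a<c c<a })
    | 𝟙-no (isRep? T (d ∷ e ∷ a ∷ b ∷ c ∷ [])) (λ { (_ , _ ∷ d<a ∷ _ ∷ _ ∷ []) → <-asym a<d d<a })
    | 𝟙-no (isRep? T (e ∷ a ∷ b ∷ c ∷ d ∷ [])) (λ { (_ , e<a ∷ _ ∷ _ ∷ _ ∷ []) → <-asym a<e e<a })
    = refl

  -- The representative from `leastFirst-exists` is a rotation of `v`, and the orbit sum is constant
  -- along the orbit. The cases are the lengths of the prefix moved to the back.
  rotations-rep-cycle : ∀ v → IsCycle T (toList v) → rotations rep v ≡ 1ℤ
  rotations-rep-cycle v@(_ ∷ _ ∷ _ ∷ _ ∷ _ ∷ []) cycle with leastFirst-exists T (toList v) cycle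
  ... | _ , ([] , _ , refl , refl) , cycle′ , least = rotations-rep-least v cycle′ least
  ... | _ , (_ ∷ [] , _ , refl , refl) , cycle′ , least =
    trans (sym (rotations-rotate rep v)) (rotations-rep-least (rotate v) cycle′ least)
  ... | _ , (_ ∷ _ ∷ [] , _ , refl , refl) , cycle′ , least =
    trans (sym (trans (rotations-rotate rep (rotate v)) (rotations-rotate rep v)))
      (rotations-rep-least (rotate (rotate v)) cycle′ least)
  ... | _ , (_ ∷ _ ∷ _ ∷ [] , _ , refl , refl) , cycle′ , least =
    trans (sym (trans (rotations-rotate rep (rotate (rotate v)))
      (trans (rotations-rotate rep (rotate v)) (rotations-rotate rep v))))
      (rotations-rep-least (rotate (rotate (rotate v))) cycle′ least)
  -- Four rotations forward are one rotation back, so a single use of `rotations-rotate` suffices.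
  ... | _ , (_ ∷ _ ∷ _ ∷ _ ∷ [] , _ , refl , refl) , cycle′ , least =
    trans (rotations-rotate rep (rotate (rotate (rotate (rotate v)))))
      (rotations-rep-least (rotate (rotate (rotate (rotate v)))) cycle′ least)
  -- Moving all five entries restores the tuple; a longer prefix is impossible.
  ... | _ , (_ ∷ _ ∷ _ ∷ _ ∷ _ ∷ [] , [] , refl , refl) , cycle′ , least = rotations-rep-least v cycle′ least
  ... | _ , (_ ∷ _ ∷ _ ∷ _ ∷ _ ∷ _ ∷ _ , _ , () , _) , _

  rep≡0 : ∀ v → ¬ IsCycle T (toList v) → rep v ≡ 0ℤ
  rep≡0 v ¬cycle = cong +_ (𝟙-no (isRep? T v) λ { (cycle , _) → ¬cycle cycle })

  rotations-rep : ∀ v → rotations rep v ≡ cyc v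
  rotations-rep v = go (isCycle? T (toList v))
    where
    ρ : Vec (Fin n) 5 → Vec (Fin n) 5
    ρ = rotate
    go : Dec (IsCycle T (toList v)) → rotations rep v ≡ cyc v
    go (yes cycle)  = trans (rotations-rep-cycle v cycle)
      (sym (cong +_ (𝟙-yes (isCycle? T (toList v)) cycle)))
    go (no ¬cycle₀) = trans (cong₂ _+_ (cong₂ _+_ (cong₂ _+_ (cong₂ _+_
        (rep≡0 v ¬cycle₀) (rep≡0 (ρ v) ¬cycle₁)) (rep≡0 (ρ (ρ v)) ¬cycle₂)) (rep≡0 (ρ (ρ (ρ v))) ¬cycle₃))
        (rep≡0 (ρ (ρ (ρ (ρ v)))) ¬cycle₄))
      (sym (cong +_ (𝟙-no (isCycle? T (toList v)) ¬cycle₀)))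
      where
      ¬cycle₁ = ¬cycle₀ ∘ IsCycle-unrotate v
      ¬cycle₂ = ¬cycle₁ ∘ IsCycle-unrotate (ρ v)
      ¬cycle₃ = ¬cycle₂ ∘ IsCycle-unrotate (ρ (ρ v))
      ¬cycle₄ = ¬cycle₃ ∘ IsCycle-unrotate (ρ (ρ (ρ v)))

  -- A cycle is traced by five tuples, the rotations of one another, and exactly one of them is the
  -- representative that `numCycles` counts.
  5*numCycles : + 5 * + numCycles T 5 ≡ ∑ⁿ 5 cyc
  5*numCycles = begin
    + 5 * + numCycles T 5   ≡⟨ cong (+ 5 *_) (length-filter-vectors 5 (isRep? T)) ⟩
    + 5 * ∑ⁿ 5 rep          ≡⟨ ∑ⁿ-rotations rep ⟨
    ∑ⁿ 5 (rotations rep)    ≡⟨ ∑ⁿ-cong 5 rotations-rep ⟩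
    ∑ⁿ 5 cyc                ∎
    where open ≡-Reasoning

  s : Fin n → Fin n → ℤ
  s u v = + bit (edge u v) - + bit (edge v u)

  skew : ∀ u v → s v u ≡ - s u v
  skew u v = flip (+ bit (edge u v)) (+ bit (edge v u))
    where
    flip : ∀ x y → y - x ≡ - (x - y)
    flip = solve-∀

  bounded : ∀ u v → s u v * s u v ≤ 1ℤ
  bounded u v with edge u v | edge v u
  ... | true  | true  = ℤ.+≤+ z≤n
  ... | true  | false = ℤ.≤-refl
  ... | false | true  = ℤ.≤-refl
  ... | false | false = ℤ.+≤+ z≤n

  open Skew s skew public
  open Bounded s skew bounded public

  -- The natural number 1 + s: 2 along an edge, 0 against it, 1 on the diagonal. A product of
  -- weights is thus nonnegative, and it is zero as soon as one step goes against an edge.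
  weight : Fin n → Fin n → ℕ
  weight u v with edge u v | edge v u
  ... | true  | true  = 1
  ... | true  | false = 2
  ... | false | true  = 0
  ... | false | false = 1

  1+s≡weight : ∀ u v → 1ℤ + s u v ≡ + weight u v
  1+s≡weight u v with edge u v | edge v u
  ... | true  | true  = refl
  ... | true  | false = refl
  ... | false | true  = refl
  ... | false | false = refl

  weight≤2 : ∀ u v → weight u v ℕ.≤ 2
  weight≤2 u v with edge u v | edge v u
  ... | true  | true  = s≤s z≤n
  ... | true  | false = s≤s (s≤s z≤n)
  ... | false | true  = z≤n
  ... | false | false = s≤s z≤n

  ⟶⇒≢ : ∀ {u v} → u ⟶ v → u ≢ v
  ⟶⇒≢ {u} uu refl = contradiction (trans (sym uu) (noLoop u)) λ ()

  ⟶⇒≡false : ∀ {u v} → u ⟶ v → edge v u ≡ false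
  ⟶⇒≡false {u} {v} uv = trans (exactlyOne u v (⟶⇒≢ uv)) (cong not uv)

  ⟶-asym : ∀ {u v} → u ⟶ v → ¬ (v ⟶ u)
  ⟶-asym uv vu = contradiction (trans (sym vu) (⟶⇒≡false uv)) λ ()

  ⟶⇒weight≡2 : ∀ {u v} → u ⟶ v → weight u v ≡ 2
  ⟶⇒weight≡2 uv rewrite uv | ⟶⇒≡false uv = refl

  weight≢0⇒ : ∀ u v → weight u v ≢ 0 → u ≡ v ⊎ u ⟶ v
  weight≢0⇒ u v w≢0 with u ≟ v
  ... | yes u≡v = inj₁ u≡v
  ... | no  u≢v with edge u v | edge v u | exactlyOne u v u≢v
  ...   | true  | _ | _    = inj₂ refl
  ...   | false | _ | refl = contradiction refl w≢0

  weights : Vec (Fin n) 5 → ℕ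
  weights (a ∷ b ∷ c ∷ d ∷ e ∷ []) =
    weight a b ℕ.* weight b c ℕ.* weight c d ℕ.* weight d e ℕ.* weight e a

  walk≡weights : ∀ v → walk v ≡ + weights v
  walk≡weights (a ∷ b ∷ c ∷ d ∷ e ∷ []) =
    pos (pos (pos (pos (1+s≡weight a b) (1+s≡weight b c)) (1+s≡weight c d)) (1+s≡weight d e)) (1+s≡weight e a)
    where
    pos : ∀ {x y j k} → x ≡ + j → y ≡ + k → x * y ≡ + (j ℕ.* k)
    pos {j = j} {k} refl refl = sym (ℤ.pos-* j k)

  weights≤32 : ∀ v → weights v ℕ.≤ 32
  weights≤32 (a ∷ b ∷ c ∷ d ∷ e ∷ []) = ℕ.*-mono-≤ (ℕ.*-mono-≤ (ℕ.*-mono-≤ (ℕ.*-mono-≤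
    (weight≤2 a b) (weight≤2 b c)) (weight≤2 c d)) (weight≤2 d e)) (weight≤2 e a)

  IsCycle⇒weights≡32 : ∀ v → IsCycle T (toList v) → weights v ≡ 32
  IsCycle⇒weights≡32 (a ∷ b ∷ c ∷ d ∷ e ∷ []) (_ , ab ∷ bc ∷ cd ∷ de ∷ ea ∷ [-])
    rewrite ⟶⇒weight≡2 ab | ⟶⇒weight≡2 bc | ⟶⇒weight≡2 cd | ⟶⇒weight≡2 de | ⟶⇒weight≡2 ea = refl

  -- On a cycle all five weights are 2, and 32 = 2⁵; elsewhere it is enough that `walk` is
  -- nonnegative.
  32*cyc≤walk : ∀ v → + 32 * cyc v ≤ walk v
  32*cyc≤walk v rewrite walk≡weights v with isCycle? T (toList v)
  ... | yes cycle = ℤ.≤-reflexive (cong +_ (sym (IsCycle⇒weights≡32 v cycle)))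
  ... | no _      = ℤ.+≤+ z≤n

  -- Two of five cyclically ordered positions are one or two steps apart. Equal vertices one step
  -- apart would give a loop, two steps apart a pair of opposite edges.
  IsCycle⁺ : ∀ {a b c d e} → a ⟶ b → b ⟶ c → c ⟶ d → d ⟶ e → e ⟶ a →
    IsCycle T (a ∷ b ∷ c ∷ d ∷ e ∷ [])
  IsCycle⁺ ab bc cd de ea =
      (⟶⇒≢ ab ∷ 2-step bc ab ∷ ≢-sym (2-step ea de) ∷ ≢-sym (⟶⇒≢ ea) ∷ []) ∷
        (⟶⇒≢ bc ∷ 2-step cd bc ∷ ≢-sym (2-step ab ea) ∷ []) ∷
        (⟶⇒≢ cd ∷ 2-step de cd ∷ []) ∷ (⟶⇒≢ de ∷ []) ∷ [] ∷ []
    , ab ∷ bc ∷ cd ∷ de ∷ ea ∷ [-]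
    where
    2-step : ∀ {x y z} → y ⟶ z → x ⟶ y → x ≢ z
    2-step yz xy refl = ⟶-asym xy yz

  -- If the product of weights is nonzero, no step goes against an edge. Either all five steps are
  -- edges and the tuple is a cycle, or some step stays in place and a rotation of `startsTwice`
  -- counts it. In both cases the right side is at least 32, the largest possible product.
  walk≤ : ∀ v → walk v ≤ + 32 * (cyc v + rotations startsTwice v)
  walk≤ v@(a ∷ b ∷ c ∷ d ∷ e ∷ []) = begin
    walk v
      ≡⟨ walk≡weights v ⟩
    + weights v
      ≤⟨ ℤ.+≤+ (bound (weights v ℕ.≟ 0)) ⟩
    + (32 ℕ.* (cycle ℕ.+ twice))
      ≡⟨ ℤ.pos-* 32 (cycle ℕ.+ twice) ⟩
    + 32 * (cyc v + rotations startsTwice v) ∎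
    where
    open ℤ.≤-Reasoning
    cycle twice : ℕ
    cycle = 𝟙 (isCycle? T (toList v))
    twice = 𝟙 (a ≟ b) ℕ.+ 𝟙 (b ≟ c) ℕ.+ 𝟙 (c ≟ d) ℕ.+ 𝟙 (d ≟ e) ℕ.+ 𝟙 (e ≟ a)
    1≤𝟙 : {P : Set} (P? : Dec P) → P → 1 ℕ.≤ 𝟙 P?
    1≤𝟙 P? p = ℕ.≤-reflexive (sym (𝟙-yes P? p))
    cycle-or-twice : a ≡ b ⊎ a ⟶ b → b ≡ c ⊎ b ⟶ c → c ≡ d ⊎ c ⟶ d → d ≡ e ⊎ d ⟶ e → e ≡ a ⊎ e ⟶ a →
      1 ℕ.≤ cycle ℕ.+ twice
    cycle-or-twice (inj₂ ab) (inj₂ bc) (inj₂ cd) (inj₂ de) (inj₂ ea) =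
      ℕ.m≤n⇒m≤n+o _ (1≤𝟙 (isCycle? T (toList v)) (IsCycle⁺ ab bc cd de ea))
    cycle-or-twice (inj₁ p) _ _ _ _ =
      ℕ.m≤n⇒m≤o+n cycle (ℕ.m≤n⇒m≤n+o _ (ℕ.m≤n⇒m≤n+o _ (ℕ.m≤n⇒m≤n+o _ (ℕ.m≤n⇒m≤n+o _ (1≤𝟙 (a ≟ b) p)))))
    cycle-or-twice _ (inj₁ p) _ _ _ =
      ℕ.m≤n⇒m≤o+n cycle (ℕ.m≤n⇒m≤n+o _ (ℕ.m≤n⇒m≤n+o _ (ℕ.m≤n⇒m≤n+o _
        (ℕ.m≤n⇒m≤o+n (𝟙 (a ≟ b)) (1≤𝟙 (b ≟ c) p)))))
    cycle-or-twice _ _ (inj₁ p) _ _ =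
      ℕ.m≤n⇒m≤o+n cycle (ℕ.m≤n⇒m≤n+o _ (ℕ.m≤n⇒m≤n+o _
        (ℕ.m≤n⇒m≤o+n (𝟙 (a ≟ b) ℕ.+ 𝟙 (b ≟ c)) (1≤𝟙 (c ≟ d) p))))
    cycle-or-twice _ _ _ (inj₁ p) _ =
      ℕ.m≤n⇒m≤o+n cycle (ℕ.m≤n⇒m≤n+o _ (ℕ.m≤n⇒m≤o+n (𝟙 (a ≟ b) ℕ.+ 𝟙 (b ≟ c) ℕ.+ 𝟙 (c ≟ d)) (1≤𝟙 (d ≟ e) p)))
    cycle-or-twice _ _ _ _ (inj₁ p) =
      ℕ.m≤n⇒m≤o+n cycle (ℕ.m≤n⇒m≤o+n (𝟙 (a ≟ b) ℕ.+ 𝟙 (b ≟ c) ℕ.+ 𝟙 (c ≟ d) ℕ.+ 𝟙 (d ≟ e)) (1≤𝟙 (e ≟ a) p))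
    left : ∀ x {y} → x ℕ.* y ≢ 0 → x ≢ 0
    left _ xy≢0 refl = xy≢0 refl
    right : ∀ x {y} → x ℕ.* y ≢ 0 → y ≢ 0
    right x xy≢0 refl = xy≢0 (ℕ.*-zeroʳ x)
    w₂ w₃ w₄ : ℕ
    w₂ = weight a b ℕ.* weight b c
    w₃ = w₂ ℕ.* weight c d
    w₄ = w₃ ℕ.* weight d e
    bound : Dec (weights v ≡ 0) → weights v ℕ.≤ 32 ℕ.* (cycle ℕ.+ twice)
    bound (yes w≡0) = ℕ.≤-trans (ℕ.≤-reflexive w≡0) z≤n
    bound (no w≢0)  = ℕ.≤-trans (weights≤32 v) (ℕ.*-monoʳ-≤ 32 (cycle-or-twice
      (weight≢0⇒ a b (left (weight a b) (left w₂ (left w₃ (left w₄ w≢0)))))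
      (weight≢0⇒ b c (right (weight a b) (left w₂ (left w₃ (left w₄ w≢0)))))
      (weight≢0⇒ c d (right w₂ (left w₃ (left w₄ w≢0))))
      (weight≢0⇒ d e (right w₃ (left w₄ w≢0)))
      (weight≢0⇒ e a (right w₄ w≢0))))

  -- 160 = 5 · 32: five tuples trace a cycle, each of weight 32.
  numCycles-upper : + 160 * + numCycles T 5 ≤ N ^ 5
  numCycles-upper = begin
    + 160 * + numCycles T 5         ≡⟨ ℤ.*-assoc (+ 32) (+ 5) (+ numCycles T 5) ⟩
    + 32 * (+ 5 * + numCycles T 5)  ≡⟨ cong (+ 32 *_) 5*numCycles ⟩
    + 32 * ∑ⁿ 5 cyc                 ≡⟨ ∑ⁿ-* 5 (+ 32) cyc ⟨
    ∑ⁿ 5 (λ v → + 32 * cyc v)       ≤⟨ ∑ⁿ-mono 5 32*cyc≤walk ⟩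
    ∑ⁿ 5 walk                       ≤⟨ ∑ⁿ-walk-upper ⟩
    N ^ 5                           ∎
    where open ℤ.≤-Reasoning

  -- The degenerate steps total 5 n⁴ over all tuples and are charged 32 each, whence 160 n⁴; the
  -- term 5 n³ comes from the trace.
  numCycles-lower : (∀ a → S 𝟏 a * S 𝟏 a ≤ 1ℤ) →
    N ^ 5 ≤ + 160 * + numCycles T 5 + + 160 * N ^ 4 + + 5 * N ^ 3
  numCycles-lower small = ℤ.≤-trans (∑ⁿ-walk-lower small) (ℤ.+-monoˡ-≤ (+ 5 * N ^ 3) (begin
    ∑ⁿ 5 walk
      ≤⟨ ∑ⁿ-mono 5 walk≤ ⟩
    ∑ⁿ 5 (λ v → + 32 * (cyc v + rotations startsTwice v))
      ≡⟨ ∑ⁿ-* 5 (+ 32) (λ v → cyc v + rotations startsTwice v) ⟩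
    + 32 * ∑ⁿ 5 (λ v → cyc v + rotations startsTwice v)
      ≡⟨ cong (+ 32 *_) (trans (∑ⁿ-+ 5 cyc (rotations startsTwice)) (cong₂ _+_ (sym 5*numCycles)
           (trans (∑ⁿ-rotations (startsTwice {n})) (cong (+ 5 *_) (∑ⁿ-startsTwice {n}))))) ⟩
    + 32 * (+ 5 * + numCycles T 5 + + 5 * N ^ 4)
      ≡⟨ expand (+ numCycles T 5) (N ^ 4) ⟩
    + 160 * + numCycles T 5 + + 160 * N ^ 4 ∎))
    where
    open ℤ.≤-Reasoning
    expand : ∀ x y → + 32 * (+ 5 * x + + 5 * y) ≡ + 160 * x + + 160 * y
    expand = solve-∀

even : Fin n → Bool
even zero    = true
even (suc u) = not (even u)

-- u → v for u < v exactly when v − u is odd, so that the signs in each row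
-- alternate on either side of the diagonal.
alternatingEdge : Fin n → Fin n → Bool
alternatingEdge zero    zero    = false
alternatingEdge zero    (suc v) = even v
alternatingEdge (suc u) zero    = not (even u)
alternatingEdge (suc u) (suc v) = alternatingEdge u v

alternating : ∀ n → Tournament n
alternating n = record { edge = alternatingEdge ; noLoop = loop ; exactlyOne = one }
  where
  loop : ∀ {n} (u : Fin n) → alternatingEdge u u ≡ false
  loop zero    = refl
  loop (suc u) = loop u

  one : ∀ {n} (u v : Fin n) → u ≢ v → alternatingEdge v u ≡ not (alternatingEdge u v)
  one zero    zero    u≢v = contradiction refl u≢v
  one zero    (suc v) _   = refl
  one (suc u) zero    _   = sym (not-involutive (even u))
  one (suc u) (suc v) u≢v = one u v (u≢v ∘ cong suc)

sign : Bool → ℤ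
sign b = + bit b - + bit (not b)

-- After the leading + comes the negated alternating sum, and 1 - x exchanges 0 and 1.
sum-even : ∀ n → sum {n} (λ v → sign (even v)) ≡ 0ℤ ⊎ sum {n} (λ v → sign (even v)) ≡ 1ℤ
sum-even zero = inj₁ refl
sum-even (suc n) = subst (λ x → 1ℤ + x ≡ 0ℤ ⊎ 1ℤ + x ≡ 1ℤ) (sym flip-sum) (go (sum-even n))
  where
  sign-not : ∀ b → sign (not b) ≡ - 1ℤ * sign b
  sign-not true  = refl
  sign-not false = refl
  flip-sum : sum {n} (λ v → sign (not (even v))) ≡ - 1ℤ * sum {n} (λ v → sign (even v))
  flip-sum = trans (sum-cong-≗ {n} (sign-not ∘ even)) (sym (*-distribˡ-sum {n} (- 1ℤ) (sign ∘ even)))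
  go : ∀ {x} → x ≡ 0ℤ ⊎ x ≡ 1ℤ → 1ℤ + - 1ℤ * x ≡ 0ℤ ⊎ 1ℤ + - 1ℤ * x ≡ 1ℤ
  go (inj₁ refl) = inj₂ refl
  go (inj₂ refl) = inj₁ refl

-- Row u sums to [n − 1 − u odd] − [u odd].
rowSum : ∀ n (u : Fin n) →
  let x = sum (Cycles.s (alternating n) u) + + bit (not (even u)) in x ≡ 0ℤ ⊎ x ≡ 1ℤ
rowSum (suc n) zero = subst (λ x → x ≡ 0ℤ ⊎ x ≡ 1ℤ) (sym (unit (sum {n} (sign ∘ even)))) (sum-even n)
  where
  unit : ∀ x → 0ℤ + x + 0ℤ ≡ x
  unit = solve-∀
rowSum (suc n) (suc u) = subst (λ x → x ≡ 0ℤ ⊎ x ≡ 1ℤ)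
  (sym (move (even u) (sum (Cycles.s (alternating n) u)))) (rowSum n u)
  where
  shift : ∀ p q r x → p - q + x + r ≡ x + (p - q + r)
  shift = solve-∀
  move : ∀ b x → + bit (not b) - + bit b + x + + bit (not (not b)) ≡ x + + bit (not b)
  move true  x = shift 0ℤ 1ℤ 1ℤ x
  move false x = shift 1ℤ 0ℤ 0ℤ x

rowSum² : ∀ n (u : Fin n) → let open Cycles (alternating n) in S 𝟏 u * S 𝟏 u ≤ 1ℤ
rowSum² n u rewrite Cycles.S𝟏 (alternating n) u =
  square≤1 (even u) (sum (Cycles.s (alternating n) u)) (rowSum n u)
  where
  solve-x : ∀ x y {z} → x + y ≡ z → x ≡ z - y
  solve-x x y refl = cancel x y
    where
    cancel : ∀ x y → x ≡ x + y - y
    cancel = solve-∀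
  square≤1 : ∀ b x → x + + bit (not b) ≡ 0ℤ ⊎ x + + bit (not b) ≡ 1ℤ → x * x ≤ 1ℤ
  square≤1 true  x (inj₁ h) rewrite solve-x x 0ℤ h = ℤ.+≤+ z≤n
  square≤1 true  x (inj₂ h) rewrite solve-x x 0ℤ h = ℤ.≤-refl
  square≤1 false x (inj₁ h) rewrite solve-x x 1ℤ h = ℤ.≤-refl
  square≤1 false x (inj₂ h) rewrite solve-x x 1ℤ h = ℤ.+≤+ z≤n

maxCycles-upper-bound : ∀ n → + 160 * + maxCycles n 5 ≤ (+ n) ^ 5
maxCycles-upper-bound n = let T , attained = maxCycles-attained n 5 in
  subst (λ c → + 160 * + c ≤ (+ n) ^ 5) attained (Cycles.numCycles-upper T)

maxCycles-lower-bound : ∀ n → (+ n) ^ 5 ≤ + 160 * + maxCycles n 5 + + 160 * (+ n) ^ 4 + + 5 * (+ n) ^ 3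
maxCycles-lower-bound n = ℤ.≤-trans (Cycles.numCycles-lower (alternating n) (rowSum² n))
  (ℤ.+-monoˡ-≤ (+ 5 * (+ n) ^ 3) (ℤ.+-monoˡ-≤ (+ 160 * (+ n) ^ 4)
    (ℤ.*-monoˡ-≤-nonNeg (+ 160) (ℤ.+≤+ (maxCycles-upper (alternating n) 5)))))

-- Comparison with the binomial coefficient

-- The falling factorial n(n - 1)(n - 2)(n - 3)(n - 4) at n = 5 + m, written without subtraction.
rising : ℕ → ℕ
rising m = (1 ℕ.+ m) ℕ.* (2 ℕ.+ m) ℕ.* (3 ℕ.+ m) ℕ.* (4 ℕ.+ m) ℕ.* (5 ℕ.+ m)

-- With 120 = 5!, both sides become (5 + m)! when multiplied by m!, which is then cancelled.
120*nC5 : ∀ m → 120 ℕ.* ((5 ℕ.+ m) C 5) ≡ rising m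
120*nC5 m = ℕ.*-cancelʳ-≡ _ _ (m !) {{m ℕ.!≢0}} (begin
  120 ℕ.* ((5 ℕ.+ m) C 5) ℕ.* m !
    ≡⟨ swap ((5 ℕ.+ m) C 5) (m !) ⟩
  ((5 ℕ.+ m) C 5) ℕ.* (120 ℕ.* m !)
    ≡⟨ cong (ℕ._* (120 ℕ.* m !)) (nCk≡n!/k![n-k]! {5 ℕ.+ m} {5} 5≤n) ⟩
  ((5 ℕ.+ m) ! ℕ./ (120 ℕ.* m !)) {{5 ℕ.!* m !≢0}} ℕ.* (120 ℕ.* m !)
    ≡⟨ m/n*n≡m {{5 ℕ.!* m !≢0}} (k![n∸k]!∣n! 5≤n) ⟩
  (5 ℕ.+ m) !
    ≡⟨ expand m (m !) ⟩
  rising m ℕ.* m ! ∎)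
  where
  open ≡-Reasoning
  5≤n : 5 ℕ.≤ 5 ℕ.+ m
  5≤n = ℕ.m≤m+n 5 m
  swap : ∀ x y → 120 ℕ.* x ℕ.* y ≡ x ℕ.* (120 ℕ.* y)
  swap = ℕ-Solver.solve-∀
  expand : ∀ k x → (5 ℕ.+ k) ℕ.* ((4 ℕ.+ k) ℕ.* ((3 ℕ.+ k) ℕ.* ((2 ℕ.+ k) ℕ.* ((1 ℕ.+ k) ℕ.* x)))) ≡
    (1 ℕ.+ k) ℕ.* (2 ℕ.+ k) ℕ.* (3 ℕ.+ k) ℕ.* (4 ℕ.+ k) ℕ.* (5 ℕ.+ k) ℕ.* x
  expand = ℕ-Solver.solve-∀

-- Integers among the rationals, and closeness to 1 by cross-multiplication

ι : ℤ → ℚ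
ι i = i / 1

ι-≃ : ∀ i → ℚ.toℚᵘ (ι i) ℚᵘ.≃ mkℚᵘ i 0
ι-≃ i = ℚ.toℚᵘ-fromℚᵘ (mkℚᵘ i 0)

ι-* : ∀ i j → ι i ℚ.* ι j ≡ ι (i * j)
ι-* i j = ℚ.toℚᵘ-injective (begin
  ℚ.toℚᵘ (ι i ℚ.* ι j)            ≈⟨ ℚ.toℚᵘ-homo-* (ι i) (ι j) ⟩
  ℚ.toℚᵘ (ι i) ℚᵘ.* ℚ.toℚᵘ (ι j)  ≈⟨ ℚᵘ.*-cong (ι-≃ i) (ι-≃ j) ⟩
  mkℚᵘ (i * j) 0                  ≈⟨ ι-≃ (i * j) ⟨
  ℚ.toℚᵘ (ι (i * j))              ∎)
  where open ℚᵘ.≃-Reasoning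

ι-+ : ∀ i j → ι i ℚ.+ ι j ≡ ι (i + j)
ι-+ i j = ℚ.toℚᵘ-injective (begin
  ℚ.toℚᵘ (ι i ℚ.+ ι j)            ≈⟨ ℚ.toℚᵘ-homo-+ (ι i) (ι j) ⟩
  ℚ.toℚᵘ (ι i) ℚᵘ.+ ℚ.toℚᵘ (ι j)  ≈⟨ ℚᵘ.+-cong (ι-≃ i) (ι-≃ j) ⟩
  mkℚᵘ i 0 ℚᵘ.+ mkℚᵘ j 0          ≈⟨ *≡* (units i j) ⟩
  mkℚᵘ (i + j) 0                  ≈⟨ ι-≃ (i + j) ⟨
  ℚ.toℚᵘ (ι (i + j))              ∎)
  where
  open ℚᵘ.≃-Reasoning
  units : ∀ i j → (i * 1ℤ + j * 1ℤ) * 1ℤ ≡ (i + j) * 1ℤ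
  units = solve-∀

ι-mono-< : ∀ {i j} → i < j → ι i ℚ.< ι j
ι-mono-< {i} {j} i<j = ℚ.toℚᵘ-cancel-< (ℚᵘ.<-respˡ-≃ (ℚᵘ.≃-sym (ι-≃ i)) (ℚᵘ.<-respʳ-≃ (ℚᵘ.≃-sym (ι-≃ j))
  (*<* (ℤ.*-monoʳ-<-pos 1ℤ i<j))))

ε*↧ε≡↥ε : ∀ ε → ε ℚ.* ι (↧ ε) ≡ ι (↥ ε)
ε*↧ε≡↥ε ε@record{} = ℚ.toℚᵘ-injective (begin
  ℚ.toℚᵘ (ε ℚ.* ι (↧ ε))          ≈⟨ ℚ.toℚᵘ-homo-* ε (ι (↧ ε)) ⟩
  ℚ.toℚᵘ ε ℚᵘ.* ℚ.toℚᵘ (ι (↧ ε))  ≈⟨ ℚᵘ.*-cong (ℚᵘ.≃-refl {ℚ.toℚᵘ ε}) (ι-≃ (↧ ε)) ⟩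
  ℚ.toℚᵘ ε ℚᵘ.* mkℚᵘ (↧ ε) 0      ≈⟨ *≡* (units (↥ ε) (↧ ε)) ⟩
  mkℚᵘ (↥ ε) 0                    ≈⟨ ι-≃ (↥ ε) ⟨
  ℚ.toℚᵘ (ι (↥ ε))                ∎)
  where
  open ℚᵘ.≃-Reasoning
  units : ∀ p q → p * q * 1ℤ ≡ p * (q * 1ℤ)
  units = solve-∀

ι-neg : ∀ i → ℚ.- ι i ≡ ι (- i)
ι-neg (+ zero)     = refl
ι-neg ℤ.+[1+ _ ]   = refl
ι-neg ℤ.-[1+ n ]   = ⁻¹-involutive (ι (+ suc n))

ι-nonNeg : ∀ k → ℚ.NonNegative (ι (+ k))
ι-nonNeg k = ℚ.normalize-nonNeg k 1

-- With x = i / D and ε = p / q, cross-multiplication reduces the comparison to i q < p D in ℤ.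
<ε : ∀ ε {x i} D → x ℚ.* ι (+ D) ≡ ι i → i * ↧ ε < ↥ ε * + D → x ℚ.< ε
<ε ε {x} {i} D x*D≡i i*q<p*D = ℚ.*-cancelʳ-<-nonNeg (ι (+ D)) {{ι-nonNeg D}}
  (ℚ.*-cancelʳ-<-nonNeg (ι (↧ ε)) {{ι-nonNeg (↧ₙ ε)}} (begin-strict
    x ℚ.* ι (+ D) ℚ.* ι (↧ ε)    ≡⟨ cong (ℚ._* ι (↧ ε)) x*D≡i ⟩
    ι i ℚ.* ι (↧ ε)              ≡⟨ ι-* i (↧ ε) ⟩
    ι (i * ↧ ε)                  <⟨ ι-mono-< i*q<p*D ⟩
    ι (↥ ε * + D)                ≡⟨ ι-* (↥ ε) (+ D) ⟨
    ι (↥ ε) ℚ.* ι (+ D)          ≡⟨ cong (ℚ._* ι (+ D)) (ε*↧ε≡↥ε ε) ⟨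
    ε ℚ.* ι (↧ ε) ℚ.* ι (+ D)    ≡⟨ ℚ.*-assoc ε (ι (↧ ε)) (ι (+ D)) ⟩
    ε ℚ.* (ι (↧ ε) ℚ.* ι (+ D))  ≡⟨ cong (ℚ._*_ ε) (ℚ.*-comm (ι (↧ ε)) (ι (+ D))) ⟩
    ε ℚ.* (ι (+ D) ℚ.* ι (↧ ε))  ≡⟨ ℚ.*-assoc ε (ι (+ D)) (ι (↧ ε)) ⟨
    ε ℚ.* ι (+ D) ℚ.* ι (↧ ε)    ∎))
  where open ℚ.≤-Reasoning

1≤↥ : ∀ ε → 0ℚ ℚ.< ε → 1ℤ ≤ ↥ ε
1≤↥ ε 0<ε = ℤ.i<j⇒suc[i]≤j (subst₂ _<_ (ℤ.*-zeroˡ (↧ ε)) (ℤ.*-identityʳ (↥ ε)) (ℚ.drop-*<* 0<ε))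

-- With q the denominator of ε, |X - D| ≤ K < D / q ≤ ε D, the last because a positive numerator is
-- at least 1. Dividing by D gives the claim, as r = X / D.
∣r-1∣<ε : ∀ ε → 0ℚ ℚ.< ε → ∀ r X D K → r ℚ.* ι (+ D) ≡ ι (+ X) →
  X ℕ.≤ D ℕ.+ K → D ℕ.≤ X ℕ.+ K → K ℕ.* ↧ₙ ε ℕ.< D → ℚ.∣ r ℚ.- 1ℚ ∣ ℚ.< ε
∣r-1∣<ε ε 0<ε r X D K r*D≡X X≤D+K D≤X+K K*q<D = go (ℚ.∣p∣≡p∨∣p∣≡-p (r ℚ.- 1ℚ))
  where
  difference : (r ℚ.- 1ℚ) ℚ.* ι (+ D) ≡ ι (+ X - + D)
  difference = begin
    (r ℚ.- 1ℚ) ℚ.* ι (+ D)                 ≡⟨ ℚ.*-distribʳ-+ (ι (+ D)) r (ℚ.- 1ℚ) ⟩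
    r ℚ.* ι (+ D) ℚ.+ ι ℤ.-1ℤ ℚ.* ι (+ D)  ≡⟨ cong₂ ℚ._+_ r*D≡X (ι-* ℤ.-1ℤ (+ D)) ⟩
    ι (+ X) ℚ.+ ι (ℤ.-1ℤ * + D)            ≡⟨ ι-+ (+ X) (ℤ.-1ℤ * + D) ⟩
    ι (+ X + ℤ.-1ℤ * + D)                  ≡⟨ cong (λ i → ι (+ X + i)) (ℤ.-1*i≡-i (+ D)) ⟩
    ι (+ X - + D)                          ∎
    where open ≡-Reasoning

  small : ∀ {i} → i ≤ + K → i * ↧ ε < ↥ ε * + D
  small {i} i≤K = begin-strict
    i * ↧ ε         ≤⟨ ℤ.*-monoʳ-≤-nonNeg (↧ ε) i≤K ⟩
    + K * + ↧ₙ ε    ≡⟨ ℤ.pos-* K (↧ₙ ε) ⟨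
    + (K ℕ.* ↧ₙ ε)  <⟨ ℤ.+<+ K*q<D ⟩
    + D             ≡⟨ ℤ.*-identityˡ (+ D) ⟨
    1ℤ * + D        ≤⟨ ℤ.*-monoʳ-≤-nonNeg (+ D) (1≤↥ ε 0<ε) ⟩
    ↥ ε * + D       ∎
    where open ℤ.≤-Reasoning

  minus-≤ : ∀ {m o} → m ℕ.≤ o ℕ.+ K → + m - + o ≤ + K
  minus-≤ {m} {o} m≤o+K = begin
    + m - + o        ≤⟨ ℤ.+-monoˡ-≤ (- + o) (ℤ.+≤+ m≤o+K) ⟩
    + o + + K - + o  ≡⟨ cancel (+ o) (+ K) ⟩
    + K              ∎
    where
    open ℤ.≤-Reasoning
    cancel : ∀ x y → x + y - x ≡ y
    cancel = solve-∀

  flip : ∀ x y → - (x - y) ≡ y - x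
  flip = solve-∀

  go : _ → _
  go (inj₁ eq) = subst (ℚ._< ε) (sym eq) (<ε ε {i = + X - + D} D difference
    (small (minus-≤ X≤D+K)))
  go (inj₂ eq) = subst (ℚ._< ε) (sym eq) (<ε ε {i = + D - + X} D
    (trans (sym (ℚ.neg-distribˡ-* (r ℚ.- 1ℚ) (ι (+ D))))
      (trans (cong ℚ.-_ difference) (trans (ι-neg (+ X - + D)) (cong ι (flip (+ X) (+ D))))))
    (small (minus-≤ D≤X+K)))

÷-* : ∀ p q .{{_ : ℚ.NonZero q}} → (p ℚ.÷ q) ℚ.* q ≡ p
÷-* p q = trans (ℚ.*-assoc p (ℚ.1/ q) q) (trans (cong (ℚ._*_ p) (ℚ.*-inverseˡ q)) (ℚ.*-identityʳ p))

120*nC5≡160*expected : ∀ n → ι (+ (120 ℕ.* (n C 5))) ≡ ι (+ 160) ℚ.* expected5Cycles n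
120*nC5≡160*expected n = begin
  ι (+ (120 ℕ.* (n C 5)))                    ≡⟨ cong ι (ℤ.pos-* 120 (n C 5)) ⟩
  ι (+ 120 * + (n C 5))                      ≡⟨ ι-* (+ 120) (+ (n C 5)) ⟨
  -- `ι (+ 160) ℚ.* (+ 3 / 4)` evaluates to `ι (+ 120)`.
  ι (+ 160) ℚ.* (+ 3 / 4) ℚ.* ι (+ (n C 5))  ≡⟨ ℚ.*-assoc (ι (+ 160)) (+ 3 / 4) (ι (+ (n C 5))) ⟩
  ι (+ 160) ℚ.* expected5Cycles n            ∎
  where open ≡-Reasoning

÷expected : ∀ n M .{{_ : ℚ.NonZero (expected5Cycles n)}} →
  (ι (+ M) ℚ.÷ expected5Cycles n) ℚ.* ι (+ (120 ℕ.* (n C 5))) ≡ ι (+ (160 ℕ.* M))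
÷expected n M = begin
  r ℚ.* ι (+ (120 ℕ.* (n C 5)))            ≡⟨ cong (ℚ._*_ r) (120*nC5≡160*expected n) ⟩
  r ℚ.* (ι (+ 160) ℚ.* expected5Cycles n)  ≡⟨ cong (ℚ._*_ r) (ℚ.*-comm (ι (+ 160)) (expected5Cycles n)) ⟩
  r ℚ.* (expected5Cycles n ℚ.* ι (+ 160))  ≡⟨ ℚ.*-assoc r (expected5Cycles n) (ι (+ 160)) ⟨
  r ℚ.* expected5Cycles n ℚ.* ι (+ 160)    ≡⟨ cong (ℚ._* ι (+ 160)) (÷-* (ι (+ M)) (expected5Cycles n)) ⟩
  ι (+ M) ℚ.* ι (+ 160)                    ≡⟨ ℚ.*-comm (ι (+ M)) (ι (+ 160)) ⟩
  ι (+ 160) ℚ.* ι (+ M)                    ≡⟨ ι-* (+ 160) (+ M) ⟩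
  ι (+ 160 * + M)                          ≡⟨ cong ι (ℤ.pos-* 160 M) ⟨
  ι (+ (160 ℕ.* M))                        ∎
  where
  open ≡-Reasoning
  r = ι (+ M) ℚ.÷ expected5Cycles n

-- Estimates in powers of n and the limit

pos-^ : ∀ n k → (+ n) ^ k ≡ + (n ℕ.^ k)
pos-^ n zero    = refl
pos-^ n (suc k) = trans (cong (_*_ (+ n)) (pos-^ n k)) (sym (ℤ.pos-* n (n ℕ.^ k)))

-- Unfolding the power at a variable avoids normalising (5 + m) ^ 4.
^4 : ∀ n → n ℕ.^ 4 ≡ n ℕ.* (n ℕ.* (n ℕ.* (n ℕ.* 1)))
^4 n = refl

-- In m = n - 5 the difference is a polynomial with nonnegative coefficients.
120*nC5≤ : ∀ {n} → 5 ℕ.≤ n → 120 ℕ.* (n C 5) ℕ.≤ n ℕ.^ 5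
120*nC5≤ {n} 5≤n = subst (λ k → 120 ℕ.* (k C 5) ℕ.≤ k ℕ.^ 5) (ℕ.m+[n∸m]≡n 5≤n) (at (n ℕ.∸ 5))
  where
  difference : ∀ m → (5 ℕ.+ m) ℕ.* ((5 ℕ.+ m) ℕ.* ((5 ℕ.+ m) ℕ.* ((5 ℕ.+ m) ℕ.* ((5 ℕ.+ m) ℕ.* 1)))) ≡
    (1 ℕ.+ m) ℕ.* (2 ℕ.+ m) ℕ.* (3 ℕ.+ m) ℕ.* (4 ℕ.+ m) ℕ.* (5 ℕ.+ m) ℕ.+
    (10 ℕ.* m ℕ.* m ℕ.* m ℕ.* m ℕ.+ 165 ℕ.* m ℕ.* m ℕ.* m ℕ.+ 1025 ℕ.* m ℕ.* m ℕ.+ 2851 ℕ.* m ℕ.+ 3005)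
  difference = ℕ-Solver.solve-∀
  at : ∀ m → 120 ℕ.* ((5 ℕ.+ m) C 5) ℕ.≤ (5 ℕ.+ m) ℕ.^ 5
  at m = begin
    120 ℕ.* ((5 ℕ.+ m) C 5)  ≡⟨ 120*nC5 m ⟩
    rising m                 ≤⟨ ℕ.m≤m+n (rising m) _ ⟩
    _                        ≡⟨ difference m ⟨
    _                        ≡⟨ cong (ℕ._*_ (5 ℕ.+ m)) (^4 (5 ℕ.+ m)) ⟨
    (5 ℕ.+ m) ℕ.^ 5          ∎
    where open ℕ.≤-Reasoning

-- The constant 10 = 1 + 2 + 3 + 4 restores the n⁴ term of n(n - 1)(n - 2)(n - 3)(n - 4); the
-- remaining difference has nonnegative coefficients in m = n - 5.
n^5≤120*nC5+ : ∀ {n} → 5 ℕ.≤ n → n ℕ.^ 5 ℕ.≤ 120 ℕ.* (n C 5) ℕ.+ 10 ℕ.* n ℕ.^ 4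
n^5≤120*nC5+ {n} 5≤n =
  subst (λ k → k ℕ.^ 5 ℕ.≤ 120 ℕ.* (k C 5) ℕ.+ 10 ℕ.* k ℕ.^ 4) (ℕ.m+[n∸m]≡n 5≤n) (at (n ℕ.∸ 5))
  where
  difference : ∀ m →
    (1 ℕ.+ m) ℕ.* (2 ℕ.+ m) ℕ.* (3 ℕ.+ m) ℕ.* (4 ℕ.+ m) ℕ.* (5 ℕ.+ m) ℕ.+
    10 ℕ.* ((5 ℕ.+ m) ℕ.* ((5 ℕ.+ m) ℕ.* ((5 ℕ.+ m) ℕ.* ((5 ℕ.+ m) ℕ.* 1)))) ≡
    (5 ℕ.+ m) ℕ.* ((5 ℕ.+ m) ℕ.* ((5 ℕ.+ m) ℕ.* ((5 ℕ.+ m) ℕ.* ((5 ℕ.+ m) ℕ.* 1)))) ℕ.+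
    (35 ℕ.* m ℕ.* m ℕ.* m ℕ.+ 475 ℕ.* m ℕ.* m ℕ.+ 2149 ℕ.* m ℕ.+ 3245)
  difference = ℕ-Solver.solve-∀
  at : ∀ m → (5 ℕ.+ m) ℕ.^ 5 ℕ.≤ 120 ℕ.* ((5 ℕ.+ m) C 5) ℕ.+ 10 ℕ.* (5 ℕ.+ m) ℕ.^ 4
  at m = begin
    (5 ℕ.+ m) ℕ.^ 5                                     ≡⟨ cong (ℕ._*_ (5 ℕ.+ m)) (^4 (5 ℕ.+ m)) ⟩
    _                                                   ≤⟨ ℕ.m≤m+n _ _ ⟩
    _                                                   ≡⟨ difference m ⟨
    _                                                   ≡⟨ cong₂ ℕ._+_ (120*nC5 m) (cong (ℕ._*_ 10) (^4 (5 ℕ.+ m))) ⟨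
    120 ℕ.* ((5 ℕ.+ m) C 5) ℕ.+ 10 ℕ.* (5 ℕ.+ m) ℕ.^ 4  ∎
    where open ℕ.≤-Reasoning

160*maxCycles≤ : ∀ n → 160 ℕ.* maxCycles n 5 ℕ.≤ n ℕ.^ 5
160*maxCycles≤ n = ℤ.drop‿+≤+ (subst₂ _≤_ (sym (ℤ.pos-* 160 (maxCycles n 5))) (pos-^ n 5)
  (maxCycles-upper-bound n))

n^5≤160*maxCycles+ : ∀ n → n ℕ.^ 5 ℕ.≤ 160 ℕ.* maxCycles n 5 ℕ.+ 160 ℕ.* n ℕ.^ 4 ℕ.+ 5 ℕ.* n ℕ.^ 3
n^5≤160*maxCycles+ n = ℤ.drop‿+≤+ (subst₂ _≤_ (pos-^ n 5)
  (cong₂ _+_ (cong₂ _+_ (sym (ℤ.pos-* 160 (maxCycles n 5))) (scale 160 4)) (scale 5 3))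
  (maxCycles-lower-bound n))
  where
  scale : ∀ c k → + c * (+ n) ^ k ≡ + (c ℕ.* n ℕ.^ k)
  scale c k = trans (cong (_*_ (+ c)) (pos-^ n k)) (sym (ℤ.pos-* c (n ℕ.^ k)))

-- Both numbers are compared with n⁵. One direction loses 10 n⁴, the other 160 n⁴ + 5 n³, and 165 n⁴
-- covers both.
120*nC5≈160*maxCycles : ∀ {n} → 5 ℕ.≤ n →
  let D = 120 ℕ.* (n C 5); X = 160 ℕ.* maxCycles n 5; K = 165 ℕ.* n ℕ.^ 4 in
  X ℕ.≤ D ℕ.+ K × D ℕ.≤ X ℕ.+ K
120*nC5≈160*maxCycles {n} 5≤n =
  (begin
    X                      ≤⟨ 160*maxCycles≤ n ⟩
    n ℕ.^ 5                ≤⟨ n^5≤120*nC5+ 5≤n ⟩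
    D ℕ.+ 10 ℕ.* n ℕ.^ 4   ≤⟨ ℕ.+-monoʳ-≤ D (ℕ.*-monoˡ-≤ (n ℕ.^ 4) (ℕ.m≤m+n 10 155)) ⟩
    D ℕ.+ 165 ℕ.* n ℕ.^ 4  ∎) ,
  (begin
    D                                        ≤⟨ 120*nC5≤ 5≤n ⟩
    n ℕ.^ 5                                  ≤⟨ n^5≤160*maxCycles+ n ⟩
    X ℕ.+ 160 ℕ.* n ℕ.^ 4 ℕ.+ 5 ℕ.* n ℕ.^ 3  ≤⟨ ℕ.+-monoʳ-≤ (X ℕ.+ 160 ℕ.* n ℕ.^ 4)
                                                   (ℕ.*-monoʳ-≤ 5 (ℕ.m≤n*m (n ℕ.^ 3) n)) ⟩
    X ℕ.+ 160 ℕ.* n ℕ.^ 4 ℕ.+ 5 ℕ.* n ℕ.^ 4  ≡⟨ collect X (n ℕ.^ 4) ⟩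
    X ℕ.+ 165 ℕ.* n ℕ.^ 4                    ∎)
  where
  open ℕ.≤-Reasoning
  instance
    n≢0 : ℕ.NonZero n
    n≢0 = ℕ.>-nonZero (ℕ.≤-trans (s≤s z≤n) 5≤n)
  D X : ℕ
  D = 120 ℕ.* (n C 5)
  X = 160 ℕ.* maxCycles n 5
  collect : ∀ x y → x ℕ.+ 160 ℕ.* y ℕ.+ 5 ℕ.* y ≡ x ℕ.+ 165 ℕ.* y
  collect = ℕ-Solver.solve-∀

-- By hypothesis n⁵ ≥ (165 q + 11) n⁴. Of this, 165 q n⁴ is the left side, 10 n⁴ pays for replacing
-- n⁵ by 120 C(n,5), and one n⁴ makes the inequality strict.
165*n^4*q<120*nC5 : ∀ {n} q → 5 ℕ.≤ n → 165 ℕ.* q ℕ.+ 11 ℕ.≤ n →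
  165 ℕ.* n ℕ.^ 4 ℕ.* q ℕ.< 120 ℕ.* (n C 5)
165*n^4*q<120*nC5 {n} q 5≤n N≤n = ℕ.+-cancelʳ-< (10 ℕ.* n ℕ.^ 4) _ _ (begin-strict
  165 ℕ.* n ℕ.^ 4 ℕ.* q ℕ.+ 10 ℕ.* n ℕ.^ 4
    <⟨ ℕ.m<m+n _ (ℕ.>-nonZero⁻¹ (n ℕ.^ 4) {{ℕ.m^n≢0 n 4 {{ℕ.>-nonZero (ℕ.≤-trans (s≤s z≤n) 5≤n)}}}}) ⟩
  165 ℕ.* n ℕ.^ 4 ℕ.* q ℕ.+ 10 ℕ.* n ℕ.^ 4 ℕ.+ n ℕ.^ 4
    ≡⟨ collect q (n ℕ.^ 4) ⟩
  (165 ℕ.* q ℕ.+ 11) ℕ.* n ℕ.^ 4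
    ≤⟨ ℕ.*-monoˡ-≤ (n ℕ.^ 4) N≤n ⟩
  n ℕ.^ 5
    ≤⟨ n^5≤120*nC5+ 5≤n ⟩
  120 ℕ.* (n C 5) ℕ.+ 10 ℕ.* n ℕ.^ 4 ∎)
  where
  open ℕ.≤-Reasoning
  collect : ∀ q y → 165 ℕ.* y ℕ.* q ℕ.+ 10 ℕ.* y ℕ.+ y ≡ (165 ℕ.* q ℕ.+ 11) ℕ.* y
  collect = ℕ-Solver.solve-∀

mainTheorem4 : Limit 5 ratio 1ℚ
-- The threshold is that of `165*n^4*q<120*nC5`, with q the denominator of ε.
mainTheorem4 ε 0<ε = 165 ℕ.* ↧ₙ ε ℕ.+ 11 , λ n 5≤n N≤n →
  let X≤D+K , D≤X+K = 120*nC5≈160*maxCycles 5≤n in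
  ∣r-1∣<ε ε 0<ε (ratio n 5≤n) (160 ℕ.* maxCycles n 5) (120 ℕ.* (n C 5)) (165 ℕ.* n ℕ.^ 4)
    (÷expected n (maxCycles n 5) {{expected5Cycles-nonZero 5≤n}})
    X≤D+K D≤X+K (165*n^4*q<120*nC5 (↧ₙ ε) 5≤n N≤n)
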